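{- For all $n,m\ge0$, \[\sum_{\alpha} x^{\mathrm{futne}(\alpha)}y^{\mathrm{enhne}(\alpha)}=\sum_{\alpha} y^{\mathrm{futne}(\alpha)}x^{\mathrm{enhne}(\alpha)},\] where both sums range over all involutions $\alpha$ of $\{1,\dots,n\}$ with exactly $m$ fixed points; i.e. $\mathrm{futne}$ and $\mathrm{enhne}$ have a symmetric joint distribution on this set.
   Context: For an involution $\alpha$ of $\{1,\dots,n\}$, its diagram has an arc $(i,j)$ for each 2-cycle $(i\ j)$, $i<j$, and each fixed point $i$ is a loop $(i,i)$. An enhanced nesting is a set of distinct arcs/loops $(i_1,j_1),\dots,(i_\ell,j_\ell)$ with $i_1<\dots<i_\ell\le j_\ell<\dots<j_1$; its number of dots is $2\ell-1$ if $i_\ell=j_\ell$ and $2\ell$ otherwise. $\mathrm{enhne}(\alpha)$ is the maximal number of dots in an enhanced nesting of $\alpha$ (equivalently, the length of a longest decreasing subsequence of $\alpha$). The open matching of $\alpha$ is obtained by replacing each fixed point by an open arc (an arc with only a left endpoint). A nesting there is either closed arcs $i_1<\dots<i_\ell<j_\ell<\dots<j_1$ ($2\ell$ dots), or $\ell-1$ such closed arcs plus an open arc with left endpoint $a<i_1$ ($2\ell-1$ dots). $\mathrm{futne}(\alpha)$ is the maximal number of dots in a nesting of the open matching of $\alpha$. -}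

module Defs where

open import Data.Nat using (ℕ; zero; suc; _+_; _*_; _≤_; _<_)
open import Data.Nat.Properties using (_≟_)
open import Data.Fin using (Fin; toℕ)
import Data.Fin.Properties as FinP
open import Data.Fin using (Fin)
open import Data.Vec using (Vec; lookup; allFin)
open import Data.List using (List; []; _∷_; length; filter)
open import Data.List.Relation.Unary.All using (All)
open import Data.List.Relation.Unary.Unique.Propositional using (Unique)
open import Data.List.Membership.Propositional using (_∈_)
open import Data.Maybe using (Maybe; just; nothing)
open import Data.Product using (Σ; _×_; _,_)
open import Data.Unit using (⊤)
open import Data.Bool using (if_then_else_)
open import Relation.Nullary.Decidable using (⌊_⌋)
open import Relation.Binary.PropositionalEquality using (_≡_)
open import Function.Bundles using (_⇔_)
import Data.Vec as V

-- A (candidate) permutation of {1,…,n} is a vector α with α(i) = lookup α i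
-- (positions 0,…,n-1 stand for 1,…,n; the order is preserved by toℕ).
Perm : ℕ → Set
Perm n = Vec (Fin n) n

IsInvolution : ∀ {n} → Perm n → Set
IsInvolution {n} α = (i : Fin n) → lookup α (lookup α i) ≡ i

fixedPoints : ∀ {n} → Perm n → ℕ
fixedPoints {n} α = length (filter (λ i → lookup α i FinP.≟ i) (V.toList (allFin n)))

ArcOrLoop : ∀ {n} → Perm n → Fin n × Fin n → Set
ArcOrLoop α (i , j) = lookup α i ≡ j × toℕ i ≤ toℕ j

ClosedArc : ∀ {n} → Perm n → Fin n × Fin n → Set
ClosedArc α (i , j) = lookup α i ≡ j × toℕ i < toℕ j

Nested : ∀ {n} → List (Fin n × Fin n) → Set
Nested [] = ⊤
Nested (_ ∷ []) = ⊤
Nested ((i , j) ∷ (i' , j') ∷ ps) = toℕ i < toℕ i' × toℕ j' < toℕ j × Nested ((i' , j') ∷ ps)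

EnhNesting : ∀ {n} → Perm n → List (Fin n × Fin n) → Set
EnhNesting α ps = All (ArcOrLoop α) ps × Nested ps

enhDots : ∀ {n} → List (Fin n × Fin n) → ℕ
enhDots [] = 0
enhDots ((i , j) ∷ []) = if ⌊ toℕ i ≟ toℕ j ⌋ then 1 else 2
enhDots (_ ∷ q ∷ ps) = 2 + enhDots (q ∷ ps)

OpenBefore : ∀ {n} → Fin n → List (Fin n × Fin n) → Set
OpenBefore a [] = ⊤
OpenBefore a ((i , _) ∷ _) = toℕ a < toℕ i

-- nesting of the open matching: optional open arc (left endpoint a, a fixed
-- point of α) plus a nested chain of closed arcs
FutNesting : ∀ {n} → Perm n → Maybe (Fin n) × List (Fin n × Fin n) → Set
FutNesting α (nothing , ps) = All (ClosedArc α) ps × Nested ps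
FutNesting α (just a , ps) =
  lookup α a ≡ a × All (ClosedArc α) ps × Nested ps × OpenBefore a ps

futDots : ∀ {n} → Maybe (Fin n) × List (Fin n × Fin n) → ℕ
futDots (nothing , ps) = 2 * length ps
futDots (just _ , ps) = 1 + 2 * length ps

IsMaxDots : {A : Set} → (A → Set) → (A → ℕ) → ℕ → Set
IsMaxDots {A} N d k = Σ A (λ x → N x × d x ≡ k) × ((x : A) → N x → d x ≤ k)

Enhne : ∀ {n} → Perm n → ℕ → Set
Enhne α = IsMaxDots (EnhNesting α) enhDots

Futne : ∀ {n} → Perm n → ℕ → Set
Futne α = IsMaxDots (FutNesting α) futDots

Fiber : (n m a b : ℕ) → Perm n → Set
Fiber n m a b α = IsInvolution α × fixedPoints α ≡ m × Futne α a × Enhne α b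

HasCount : ∀ {n} → (Perm n → Set) → ℕ → Set
HasCount {n} P k =
  Σ (List (Perm n)) λ l → Unique l × ((α : Perm n) → (α ∈ l) ⇔ P α) × length l ≡ k

-- Removing the loop or the open arc from a nesting costs exactly one dot, so futne and enhne
-- both lie in {2M, 2M+1}, where M is the largest number of pairwise nested closed arcs.
-- Hence the two fibers to be compared are the differences F ∖ E and E ∖ F of the sets
-- F = {futne ≤ 2M} and E = {enhne ≤ 2M}, and it suffices to show |E| = |F|.
--
-- Sweep an involution from right to left and record at each time t the word of the openers
-- of the arcs crossing t, ordered by decreasing closer.  An opener deletes the largest letter,
-- a closer appends a letter, and increasing subsequences are the nestings over t.  So E counts
-- the sweeps from the empty word in which words have no increasing subsequence longer than M,
-- and a fixed point is only allowed at words in which they are even shorter than M.  Treating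
-- the open arcs as mutually crossing, F counts the sweeps without fixed points which start from
-- the decreasing word of length m.
--
-- More generally the number of sweeps with m fixed points from a word σ is the sum of the
-- numbers of sweeps without fixed points from σ a₁ … aₘ over all a₁ > … > aₘ.  This follows by
-- induction on the length of the sweep: if a₁ is the maximum of the new word, then deleting it
-- plays the part of a fixed point, and appending a decreasing run and then a letter matches
-- appending a letter and then a decreasing run, because the resulting words are Knuth
-- equivalent and the number of sweeps is a Knuth invariant.

module Submission where

open import Defs
open import Data.Empty using (⊥)
open import Data.Fin using (Fin; toℕ; fromℕ<)
import Data.Fin.Properties as FinP
open import Data.List using (List; []; _∷_; [_]; _++_; filter; length; map; replicate)
open import Data.List.Membership.DecPropositional using () renaming (_∈?_ to member?)
open import Data.List.Membership.Propositional using (_∈_; _∉_)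
open import Data.List.Membership.Propositional.Properties
  using (∈-filter⁺; ∈-filter⁻; ∈-map⁺; ∈-map⁻; ∈-++⁺ˡ; ∈-++⁺ʳ; ∈-++⁻)
open import Data.List.Membership.Propositional.Properties.WithK using (unique∧set⇒bag)
open import Data.List.Properties
  using (++-identityʳ; length-++; length-map; length-replicate; map-++; ∷-injective; ∷-injectiveˡ; ∷-injectiveʳ)
open import Data.List.Relation.Binary.BagAndSetEquality using (∼bag⇒↭)
open import Data.List.Relation.Binary.Permutation.Propositional.Properties using (↭-length)
open import Data.List.Relation.Binary.Pointwise using (Pointwise; []; _∷_; Pointwise-length)
open import Data.List.Relation.Unary.All as All using (All; []; _∷_)
import Data.List.Relation.Unary.All.Properties as AllP
open import Data.List.Relation.Unary.AllPairs as AllPairs using (AllPairs; []; _∷_)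
import Data.List.Relation.Unary.AllPairs.Properties as AllPairsP
open import Data.List.Relation.Unary.Any using (here; there)
open import Data.List.Relation.Unary.Linked as Linked using (Linked; []; [-]; _∷_)
open import Data.List.Relation.Unary.Unique.Propositional using (Unique)
import Data.List.Relation.Unary.Unique.Propositional.Properties as UniqueP
open import Data.Maybe using (Maybe; just; nothing)
open import Data.Nat
open import Data.Nat.Properties
open import Data.Product using (Σ; ∃; _×_; _,_; proj₁; proj₂)
open import Data.Sum using (_⊎_; inj₁; inj₂)
open import Data.Unit using (⊤; tt)
open import Data.Vec as Vec using (allFin; lookup)
open import Data.Vec.Membership.Propositional.Properties using (∈-allFin⁺; ∈-toList⁺)
import Data.Vec.Properties as VecP
open import Function using (_∘_; id)
open import Function.Bundles using (_⇔_; mk⇔; Equivalence)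
open import Relation.Binary using (DecidableEquality)
open import Relation.Binary.PropositionalEquality hiding ([_])
open import Relation.Nullary using (Dec; yes; no; ¬_; ¬?; contradiction)
open import Relation.Nullary.Decidable using (map′)

open Equivalence using (to; from)

-- Membership, and numbers gated by a decision

infix 4 _∈?_

_∈?_ : (x : ℕ) (p : List ℕ) → Dec (x ∈ p)
_∈?_ = member? _≟_

gate : {P : Set} → Dec P → ℕ → ℕ
gate (yes _) x = x
gate (no _)  _ = 0

gate-yes : {P : Set} (d : Dec P) {x : ℕ} → P → gate d x ≡ x
gate-yes (yes _) p = refl
gate-yes (no ¬p) p = contradiction p ¬p

gate-no : {P : Set} (d : Dec P) {x : ℕ} → ¬ P → gate d x ≡ 0
gate-no (yes p) ¬p = contradiction p ¬p
gate-no (no _)  ¬p = refl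

gate-zero : {P : Set} (d : Dec P) → gate d 0 ≡ 0
gate-zero (yes _) = refl
gate-zero (no _)  = refl

gate-+ : {P : Set} (d : Dec P) (x y : ℕ) → gate d (x + y) ≡ gate d x + gate d y
gate-+ (yes _) x y = refl
gate-+ (no _)  x y = refl

gate-cong : {P Q : Set} (d : Dec P) (e : Dec Q) {x y : ℕ} →
            (P → Q) → (Q → P) → (P → Q → x ≡ y) → gate d x ≡ gate e y
gate-cong (yes p) (yes q) f g h = h p q
gate-cong (yes p) (no ¬q) f g h = contradiction (f p) ¬q
gate-cong (no ¬p) (yes q) f g h = contradiction (g q) ¬p
gate-cong (no _)  (no _)  f g h = refl

+-exchange : ∀ a b c d → (a + b) + (c + d) ≡ (a + c) + (b + d)
+-exchange a b c d = begin
  (a + b) + (c + d)  ≡⟨ +-assoc a b (c + d) ⟩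
  a + (b + (c + d))  ≡⟨ cong (a +_) (sym (+-assoc b c d)) ⟩
  a + ((b + c) + d)  ≡⟨ cong (λ x → a + (x + d)) (+-comm b c) ⟩
  a + ((c + b) + d)  ≡⟨ cong (a +_) (+-assoc c b d) ⟩
  a + (c + (b + d))  ≡⟨ sym (+-assoc a c (b + d)) ⟩
  (a + c) + (b + d)  ∎
  where open ≡-Reasoning

-- Interval sums

-- The range is half-open. Gating at the lower end avoids subtraction and makes the sum zero when
-- `hi ≤ lo`.
sumFrom : ℕ → ℕ → (ℕ → ℕ) → ℕ
sumFrom lo zero     g = 0
sumFrom lo (suc hi) g = sumFrom lo hi g + gate (lo ≤? hi) (g hi)

sum-cong : ∀ lo hi {g h : ℕ → ℕ} → (∀ i → lo ≤ i → i < hi → g i ≡ h i) →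
           sumFrom lo hi g ≡ sumFrom lo hi h
sum-cong lo zero     eq = refl
sum-cong lo (suc hi) eq = cong₂ _+_
  (sum-cong lo hi λ i l u → eq i l (m<n⇒m<1+n u))
  (gate-cong (lo ≤? hi) (lo ≤? hi) (λ p → p) (λ p → p) λ p _ → eq hi p (n<1+n hi))

sum-zero : ∀ lo hi {g : ℕ → ℕ} → (∀ i → lo ≤ i → i < hi → g i ≡ 0) → sumFrom lo hi g ≡ 0
sum-zero lo hi eq = trans (sum-cong lo hi eq) (zeros hi)
  where
  zeros : ∀ hi → sumFrom lo hi (λ _ → 0) ≡ 0
  zeros zero     = refl
  zeros (suc hi) = cong₂ _+_ (zeros hi) (gate-zero (lo ≤? hi))

sum-+ : ∀ lo hi (g h : ℕ → ℕ) → sumFrom lo hi (λ i → g i + h i) ≡ sumFrom lo hi g + sumFrom lo hi h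
sum-+ lo zero     g h = refl
sum-+ lo (suc hi) g h = trans
  (cong₂ _+_ (sum-+ lo hi g h) (gate-+ (lo ≤? hi) (g hi) (h hi)))
  (+-exchange (sumFrom lo hi g) _ _ _)

sum-gate : ∀ {P : Set} (d : Dec P) lo hi (g : ℕ → ℕ) → gate d (sumFrom lo hi g) ≡ sumFrom lo hi (λ i → gate d (g i))
sum-gate (yes _) lo hi g = refl
sum-gate (no _)  lo hi g = sym (sum-zero lo hi (λ _ _ _ → refl))

sum-swap : ∀ lo hi lo′ hi′ (h : ℕ → ℕ → ℕ) →
  sumFrom lo hi (λ i → sumFrom lo′ hi′ (h i)) ≡ sumFrom lo′ hi′ (λ j → sumFrom lo hi (λ i → h i j))
sum-swap lo zero     lo′ hi′ h = sym (sum-zero lo′ hi′ (λ _ _ _ → refl))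
sum-swap lo (suc hi) lo′ hi′ h = trans
  (cong₂ _+_ (sum-swap lo hi lo′ hi′ h) (sum-gate (lo ≤? hi) lo′ hi′ (h hi)))
  (sym (sum-+ lo′ hi′ _ _))

sum-split : ∀ lo mid hi (g : ℕ → ℕ) → lo ≤ mid → mid ≤ hi →
            sumFrom lo hi g ≡ sumFrom lo mid g + sumFrom mid hi g
sum-split lo mid hi g l u with m≤n⇒m<n∨m≡n u
... | inj₂ refl = sym (trans (cong (sumFrom lo mid g +_)
                    (sum-zero mid mid λ i p q → contradiction p (<⇒≱ q))) (+-identityʳ _))
sum-split lo mid (suc hi) g l u | inj₁ (s≤s q) = trans
  (cong₂ _+_ (sum-split lo mid hi g l q)
    (trans (gate-yes (lo ≤? hi) (≤-trans l q)) (sym (gate-yes (mid ≤? hi) q))))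
  (+-assoc (sumFrom lo mid g) _ _)

sum-suc : ∀ lo hi (g : ℕ → ℕ) → sumFrom (suc lo) (suc hi) g ≡ sumFrom lo hi (g ∘ suc)
sum-suc lo zero     g = gate-no (suc lo ≤? 0) {g 0} λ ()
sum-suc lo (suc hi) g = cong₂ _+_ (sum-suc lo hi g)
  (gate-cong (suc lo ≤? suc hi) (lo ≤? hi) s≤s⁻¹ s≤s λ _ _ → refl)

sum-shift : ∀ k lo hi (g : ℕ → ℕ) → sumFrom (k + lo) (k + hi) g ≡ sumFrom lo hi (λ i → g (k + i))
sum-shift zero    lo hi g = refl
sum-shift (suc k) lo hi g = trans (sum-suc (k + lo) (k + hi) g) (sum-shift k lo hi (g ∘ suc))

sum-one : ∀ n (g : ℕ → ℕ) → sumFrom n (suc n) g ≡ g n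
sum-one n g = cong₂ _+_ (sum-zero n n λ i p q → contradiction p (<⇒≱ q)) (gate-yes (n ≤? n) ≤-refl)

sum-triangle : ∀ n (h : ℕ → ℕ → ℕ) →
  sumFrom 0 n (λ a → sumFrom 0 (suc a) (h a)) ≡ sumFrom 0 n (λ b → sumFrom b n (λ a → h a b))
sum-triangle zero    h = refl
sum-triangle (suc n) h = begin
  sumFrom 0 n (λ a → sumFrom 0 (suc a) (h a)) + sumFrom 0 (suc n) (h n)
    ≡⟨ cong₂ _+_ (sum-triangle n h) refl ⟩
  sumFrom 0 n (λ b → sumFrom b n (λ a → h a b)) + (sumFrom 0 n (h n) + h n n)
    ≡⟨ sym (+-assoc (sumFrom 0 n (λ b → sumFrom b n (λ a → h a b))) _ _) ⟩
  (sumFrom 0 n (λ b → sumFrom b n (λ a → h a b)) + sumFrom 0 n (h n)) + h n n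
    ≡⟨ cong (_+ h n n) (sym (sum-+ 0 n _ _)) ⟩
  sumFrom 0 n (λ b → sumFrom b n (λ a → h a b) + h n b) + h n n
    ≡⟨ cong₂ _+_ (sum-cong 0 n λ b _ b<n → cong (sumFrom b n (λ a → h a b) +_)
                    (sym (gate-yes (b ≤? n) (<⇒≤ b<n))))
                 (sym (sum-one n (λ a → h a n))) ⟩
  sumFrom 0 n (λ b → sumFrom b (suc n) (λ a → h a b)) + sumFrom n (suc n) (λ a → h a n) ∎
  where open ≡-Reasoning

-- Sums over decreasing runs

-- A word is represented by a list of ranks, its last letter first: the rank of a letter is the
-- number of smaller letters before it in the word.  So appending a letter is consing a rank, and
-- a run of letters is decreasing iff its ranks are weakly decreasing.  desc sums over the
-- decreasing runs of length m whose first rank is at most B; g also receives the last rank.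
desc : ℕ → (ℕ → List ℕ → ℕ) → ℕ → List ℕ → ℕ
desc zero    g B σ = g B σ
desc (suc m) g B σ = sumFrom 0 (suc B) λ c → desc m g c (c ∷ σ)

desc-cong : ∀ m {g h} B σ →
  (∀ B′ τ → B′ ≤ B → length τ ≡ m + length σ → g B′ τ ≡ h B′ τ) →
  desc m g B σ ≡ desc m h B σ
desc-cong zero    B σ eq = eq B σ ≤-refl refl
desc-cong (suc m) B σ eq = sum-cong 0 (suc B) λ c _ c≤B →
  desc-cong m c (c ∷ σ) λ B′ τ B′≤c len →
    eq B′ τ (≤-trans B′≤c (s≤s⁻¹ c≤B)) (trans len (+-suc m (length σ)))

desc-+ : ∀ m g h B σ → desc m (λ B τ → g B τ + h B τ) B σ ≡ desc m g B σ + desc m h B σ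
desc-+ zero    g h B σ = refl
desc-+ (suc m) g h B σ = trans (sum-cong 0 (suc B) λ c _ _ → desc-+ m g h c (c ∷ σ))
                               (sum-+ 0 (suc B) _ _)

desc-sum : ∀ m lo hi (h : ℕ → ℕ → List ℕ → ℕ) B σ →
  desc m (λ B τ → sumFrom lo hi (λ b → h b B τ)) B σ ≡ sumFrom lo hi (λ b → desc m (h b) B σ)
desc-sum zero    lo hi h B σ = refl
desc-sum (suc m) lo hi h B σ = trans (sum-cong 0 (suc B) λ c _ _ → desc-sum m lo hi h c (c ∷ σ))
                                     (sum-swap 0 (suc B) lo hi _)

-- A letter after a run with last rank `B` is smaller than the last run letter exactly when its rank
-- is at most `B`; it then prolongs the run.
desc-snoc : ∀ m f B σ → desc m (λ B τ → sumFrom 0 (suc B) (λ c → f (c ∷ τ))) B σ ≡ desc (suc m) (λ _ → f) B σ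
desc-snoc zero    f B σ = refl
desc-snoc (suc m) f B σ = sum-cong 0 (suc B) λ c _ _ → desc-snoc m f c (c ∷ σ)

-- Knuth relations, and the exchange of a run with a letter

infix 4 _~_

-- The elementary Knuth relations for letters x < y < z, in terms of ranks.
data _~_ : List ℕ → List ℕ → Set where
  yxz : ∀ {a b c ρ} → a ≤ c → c < b → b ≤ suc (length ρ) →
        suc b ∷ a ∷ c ∷ ρ ~ a ∷ b ∷ c ∷ ρ
  xzy : ∀ {a b d ρ} → a < d → d ≤ suc b → a ≤ b → b ≤ length ρ →
        d ∷ suc b ∷ a ∷ ρ ~ d ∷ a ∷ b ∷ ρ
  _∷_ : ∀ c {σ τ} → σ ~ τ → c ∷ σ ~ c ∷ τ

Plactic : (List ℕ → ℕ) → Set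
Plactic f = ∀ {σ τ} → σ ~ τ → f σ ≡ f τ

~-length : ∀ {σ τ} → σ ~ τ → length σ ≡ length τ
~-length (yxz _ _ _)   = refl
~-length (xzy _ _ _ _) = refl
~-length (c ∷ r)       = cong suc (~-length r)

desc-plactic : ∀ m {f} → Plactic f → ∀ B → Plactic (desc m (λ _ → f) B)
desc-plactic zero    pf B r = pf r
desc-plactic (suc m) pf B r = sum-cong 0 (suc B) λ c _ _ → desc-plactic m pf c (c ∷ r)

module Exchange (f : List ℕ → ℕ) (pf : Plactic f) where

  -- The Knuth relation yxz moves the large letter to the left past one run letter after another;
  -- the letter in front of the one passed is the pivot. Each passed letter no longer counts towards
  -- its rank, which drops from `m + b` to `b`.
  pull-big : ∀ m y b ρ → y < b → b ≤ suc (length ρ) →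
    desc m (λ _ τ → f (m + b ∷ τ)) y (y ∷ ρ) ≡ desc m (λ _ → f) y (b ∷ y ∷ ρ)
  pull-big zero    y b ρ y<b b≤ = refl
  pull-big (suc m) y b ρ y<b b≤ = sum-cong 0 (suc y) λ c _ c≤y → begin
    desc m (λ _ τ → f (suc m + b ∷ τ)) c (c ∷ y ∷ ρ)
      ≡⟨ cong (λ x → desc m (λ _ τ → f (x ∷ τ)) c (c ∷ y ∷ ρ)) (sym (+-suc m b)) ⟩
    desc m (λ _ τ → f (m + suc b ∷ τ)) c (c ∷ y ∷ ρ)
      ≡⟨ pull-big m c (suc b) (y ∷ ρ) (s≤s (≤-trans (s≤s⁻¹ c≤y) (<⇒≤ y<b))) (s≤s b≤) ⟩
    desc m (λ _ → f) c (suc b ∷ c ∷ y ∷ ρ)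
      ≡⟨ desc-plactic m pf c (yxz (s≤s⁻¹ c≤y) y<b b≤) ⟩
    desc m (λ _ → f) c (c ∷ b ∷ y ∷ ρ) ∎
    where open ≡-Reasoning

  -- Sums over the appended words a₁ > … > aₘ₊₁ < b, respectively b < a₁ > … > aₘ₊₁, all of
  -- whose letters lie in the first L + 1 gaps of σ.
  descAsc ascDesc : ℕ → ℕ → List ℕ → ℕ
  descAsc m L σ = desc (suc m) (λ B τ → sumFrom (suc B) (suc (suc m + L)) λ b → f (b ∷ τ)) L σ
  ascDesc m L σ = sumFrom 0 (suc L) λ b → sumFrom (suc b) (suc (suc L)) λ a →
                    desc m (λ _ → f) a (a ∷ b ∷ σ)

  -- By induction on the run length. Let a be the first letter of a word on the left. If b > a, then
  -- `pull-big` moves b next to a, which gives a < b > a₂ > ... with a₂ < a. If b < a, the induction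
  -- hypothesis turns the letters after a into b′ < a₂ > ..., all below a, and the relation xzy
  -- turns a b′ a₂ into b′ a a₂, which gives b′ < a > a₂ > ... with a₂ > b′. These are the words on
  -- the right, sorted by whether the third letter is below or above the first.
  descAsc≡ascDesc : ∀ m L σ → L ≤ length σ → descAsc m L σ ≡ ascDesc m L σ
  descAsc≡ascDesc zero    L σ L≤ = refl
  descAsc≡ascDesc (suc m) L σ L≤ = begin
    sumFrom 0 (suc L) (λ a → desc (suc m) (λ B τ → sumFrom (suc B) (suc (suc (suc m) + L)) λ b → f (b ∷ τ)) a (a ∷ σ))
      ≡⟨ sum-cong 0 (suc L) split ⟩
    sumFrom 0 (suc L) (λ a → descAsc m a (a ∷ σ) +
       sumFrom (suc a) (suc (suc L)) (λ b → desc (suc m) (λ _ → f) a (b ∷ a ∷ σ)))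
      ≡⟨ sum-+ 0 (suc L) _ _ ⟩
    sumFrom 0 (suc L) (λ a → descAsc m a (a ∷ σ)) + small
      ≡⟨ cong (_+ small) (trans (sum-cong 0 (suc L) inner) (sum-triangle (suc L) big-step)) ⟩
    sumFrom 0 (suc L) (λ b → sumFrom b (suc L) (λ a → big-step a b)) + small
      ≡⟨ +-comm _ small ⟩
    small + sumFrom 0 (suc L) (λ b → sumFrom b (suc L) (λ a → big-step a b))
      ≡⟨ sym (sum-+ 0 (suc L) _ _) ⟩
    sumFrom 0 (suc L) (λ b →
       sumFrom (suc b) (suc (suc L)) (λ a → desc (suc m) (λ _ → f) b (a ∷ b ∷ σ)) +
       sumFrom b (suc L) (λ a → big-step a b))
      ≡⟨ sum-cong 0 (suc L) join ⟩
    ascDesc (suc m) L σ ∎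
    where
    open ≡-Reasoning
    -- `small` and `big-step` sum over the words of `ascDesc` whose third letter is below,
    -- respectively above, the first one. In `big-step` the second letter has rank `suc a` because
    -- the smaller first letter, of rank `b`, now precedes it.
    small : ℕ
    small = sumFrom 0 (suc L) λ a → sumFrom (suc a) (suc (suc L)) λ b →
              desc (suc m) (λ _ → f) a (b ∷ a ∷ σ)
    big-step : ℕ → ℕ → ℕ
    big-step a b = sumFrom (suc b) (suc (suc a)) λ a₂ → desc m (λ _ → f) a₂ (a₂ ∷ suc a ∷ b ∷ σ)

    -- The `suc m` run letters after a are all below a, so the final letter is above a exactly when
    -- its rank exceeds `suc m + a`. The inner sum is cut there.
    split : ∀ a → 0 ≤ a → a < suc L →
      desc (suc m) (λ B τ → sumFrom (suc B) (suc (suc (suc m) + L)) λ b → f (b ∷ τ)) a (a ∷ σ) ≡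
      descAsc m a (a ∷ σ) + sumFrom (suc a) (suc (suc L)) (λ b → desc (suc m) (λ _ → f) a (b ∷ a ∷ σ))
    split a _ (s≤s a≤L) = begin
      desc (suc m) (λ B τ → sumFrom (suc B) (suc (suc (suc m) + L)) λ b → f (b ∷ τ)) a (a ∷ σ)
        ≡⟨ desc-cong (suc m) a (a ∷ σ) (λ B τ B≤a _ →
             sum-split (suc B) (suc (suc m + a)) (suc (suc (suc m) + L)) _
               (s≤s (m≤n⇒m≤o+n (suc m) B≤a)) (s≤s (+-mono-≤ (n≤1+n (suc m)) a≤L))) ⟩
      desc (suc m) (λ B τ → sumFrom (suc B) (suc (suc m + a)) (λ b → f (b ∷ τ)) +
                      sumFrom (suc (suc m + a)) (suc (suc (suc m) + L)) (λ b → f (b ∷ τ))) a (a ∷ σ)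
        ≡⟨ desc-+ (suc m) _ _ a (a ∷ σ) ⟩
      descAsc m a (a ∷ σ) + desc (suc m) (λ _ τ → sumFrom (suc (suc m + a)) (suc (suc (suc m) + L)) (λ b → f (b ∷ τ))) a (a ∷ σ)
        ≡⟨ cong (descAsc m a (a ∷ σ) +_) (desc-cong (suc m) a (a ∷ σ) λ B τ _ _ →
             trans (cong₂ (λ x y → sumFrom x y (λ b → f (b ∷ τ)))
                      (sym (+-suc (suc m) a))
                      (cong suc (trans (cong suc (sym (+-suc m L))) (sym (+-suc m (suc L))))))
                   (sum-shift (suc m) (suc a) (suc (suc L)) (λ b → f (b ∷ τ)))) ⟩
      descAsc m a (a ∷ σ) + desc (suc m) (λ _ τ → sumFrom (suc a) (suc (suc L)) (λ b → f (suc m + b ∷ τ))) a (a ∷ σ)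
        ≡⟨ cong (descAsc m a (a ∷ σ) +_) (trans
             (desc-sum (suc m) (suc a) (suc (suc L)) _ a (a ∷ σ))
             (sum-cong (suc a) (suc (suc L)) λ b a<b b≤ →
                pull-big (suc m) a b σ a<b (≤-trans (s≤s⁻¹ b≤) (s≤s L≤)))) ⟩
      descAsc m a (a ∷ σ) + sumFrom (suc a) (suc (suc L)) (λ b → desc (suc m) (λ _ → f) a (b ∷ a ∷ σ)) ∎

    inner : ∀ a → 0 ≤ a → a < suc L → descAsc m a (a ∷ σ) ≡ sumFrom 0 (suc a) (big-step a)
    inner a _ (s≤s a≤L) = trans
      (descAsc≡ascDesc m a (a ∷ σ) (m≤n⇒m≤1+n (≤-trans a≤L L≤)))
      (sum-cong 0 (suc a) λ b _ b≤a → sum-cong (suc b) (suc (suc a)) λ a₂ b<a₂ a₂≤ →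
         sym (desc-plactic m pf a₂ (xzy b<a₂ (s≤s⁻¹ a₂≤) (s≤s⁻¹ b≤a) (≤-trans a≤L L≤))))

    join : ∀ b → 0 ≤ b → b < suc L →
      sumFrom (suc b) (suc (suc L)) (λ a → desc (suc m) (λ _ → f) b (a ∷ b ∷ σ)) +
      sumFrom b (suc L) (λ a → big-step a b) ≡
      sumFrom (suc b) (suc (suc L)) λ a → desc (suc m) (λ _ → f) a (a ∷ b ∷ σ)
    join b _ _ = trans
      (cong (sumFrom (suc b) (suc (suc L)) (λ a → desc (suc m) (λ _ → f) b (a ∷ b ∷ σ)) +_)
        (sym (sum-suc b (suc L) (λ a → sumFrom (suc b) (suc a) λ a₂ → desc m (λ _ → f) a₂ (a₂ ∷ a ∷ b ∷ σ)))))
      (trans (sym (sum-+ (suc b) (suc (suc L)) _ _))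
        (sum-cong (suc b) (suc (suc L)) λ a b<a _ →
           sym (sum-split 0 (suc b) (suc a) _ z≤n (m≤n⇒m≤1+n b<a))))

  -- On the left the final letter either prolongs the run or exceeds its last letter; on the right
  -- the initial letter either starts a longer run or is below the next letter. The decreasing cases
  -- coincide, and the others are matched by `descAsc≡ascDesc`.
  exchange : ∀ m σ →
    desc m (λ _ τ → sumFrom 0 (suc (length τ)) (λ b → f (b ∷ τ))) (length σ) σ ≡
    sumFrom 0 (suc (length σ)) (λ b → desc m (λ _ → f) (suc (length σ)) (b ∷ σ))
  exchange zero    σ = refl
  exchange (suc m) σ = begin
    desc (suc m) (λ _ τ → sumFrom 0 (suc (length τ)) (λ b → f (b ∷ τ))) (length σ) σ
      ≡⟨ desc-cong (suc m) (length σ) σ (λ B τ B≤ len → trans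
           (sum-split 0 (suc B) (suc (length τ)) _ z≤n
              (s≤s (≤-trans B≤ (≤-trans (m≤n+m _ (suc m)) (≤-reflexive (sym len))))))
           (cong (λ x → sumFrom 0 (suc B) (λ b → f (b ∷ τ)) + sumFrom (suc B) (suc x) (λ b → f (b ∷ τ))) len)) ⟩
    desc (suc m) (λ B τ → sumFrom 0 (suc B) (λ b → f (b ∷ τ)) +
                          sumFrom (suc B) (suc (suc m + length σ)) (λ b → f (b ∷ τ))) (length σ) σ
      ≡⟨ desc-+ (suc m) _ _ (length σ) σ ⟩
    desc (suc m) (λ B τ → sumFrom 0 (suc B) (λ b → f (b ∷ τ))) (length σ) σ + descAsc m (length σ) σ
      ≡⟨ cong₂ _+_ (desc-snoc (suc m) f (length σ) σ) (descAsc≡ascDesc m (length σ) σ ≤-refl) ⟩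
    sumFrom 0 (suc (length σ)) (λ b → desc (suc m) (λ _ → f) b (b ∷ σ)) + ascDesc m (length σ) σ
      ≡⟨ sym (sum-+ 0 (suc (length σ)) _ _) ⟩
    sumFrom 0 (suc (length σ)) (λ b → desc (suc m) (λ _ → f) b (b ∷ σ) +
       sumFrom (suc b) (suc (suc (length σ))) λ a → desc m (λ _ → f) a (a ∷ b ∷ σ))
      ≡⟨ sum-cong 0 (suc (length σ)) (λ b _ b≤ →
           sym (sum-split 0 (suc b) (suc (suc (length σ))) _ z≤n (m≤n⇒m≤1+n b≤))) ⟩
    sumFrom 0 (suc (length σ)) (λ b → desc (suc m) (λ _ → f) (suc (length σ)) (b ∷ σ)) ∎
    where open ≡-Reasoning

-- First rows of insertion tableaux

Valid : List ℕ → Set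
Valid []      = ⊤
Valid (c ∷ σ) = c ≤ length σ × Valid σ

-- Insertion into the first row of the Robinson–Schensted tableau, whose entries are given by
-- their ranks among all letters; the bumped entry is dropped.
bump : ℕ → List ℕ → List ℕ
bump c []       = [ c ]
bump c (r ∷ rs) with r <? c
... | yes _ = r ∷ bump c rs
... | no  _ = c ∷ map suc rs

bump-< : ∀ {c r} rs → r < c → bump c (r ∷ rs) ≡ r ∷ bump c rs
bump-< {c} {r} rs r<c with r <? c
... | yes _ = refl
... | no ¬p = contradiction r<c ¬p

bump-≥ : ∀ {c r} rs → c ≤ r → bump c (r ∷ rs) ≡ c ∷ map suc rs
bump-≥ {c} {r} rs c≤r with r <? c
... | yes p = contradiction p (≤⇒≯ c≤r)
... | no _  = refl

row : List ℕ → List ℕ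
row []      = []
row (c ∷ σ) = bump c (row σ)

-- By Schensted's theorem, the length of a longest increasing subsequence. `chain-width` and
-- `wide-chain` establish this in terms of nestings.
width : List ℕ → ℕ
width σ = length (row σ)

length-bump-≤ : ∀ c rs → length rs ≤ length (bump c rs)
length-bump-≤ c []       = z≤n
length-bump-≤ c (r ∷ rs) with r <? c
... | yes _ = s≤s (length-bump-≤ c rs)
... | no  _ = s≤s (≤-reflexive (sym (length-map suc rs)))

Ascending : List ℕ → Set
Ascending = AllPairs _<_

map-suc-ascending : ∀ {rs} → Ascending rs → Ascending (map suc rs)
map-suc-ascending []       = []
map-suc-ascending (p ∷ ps) = AllP.map⁺ (All.map s≤s p) ∷ map-suc-ascending ps

bump-all : ∀ {P : ℕ → Set} {c} rs → P c → All P rs → (∀ {x} → P x → P (suc x)) → All P (bump c rs)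
bump-all []       pc []       step = pc ∷ []
bump-all {c = c} (r ∷ rs) pc (p ∷ ps) step with r <? c
... | yes _ = p ∷ bump-all rs pc ps step
... | no  _ = pc ∷ AllP.map⁺ (All.map step ps)

bump-ascending : ∀ c {rs} → Ascending rs → Ascending (bump c rs)
bump-ascending c []       = [] ∷ []
bump-ascending c (_∷_ {r} {rs} p ps) with r <? c
... | yes r<c = bump-all rs r<c p m<n⇒m<1+n ∷ bump-ascending c ps
... | no  r≮c = AllP.map⁺ (All.map (λ r<x → s≤s (≤-trans (≮⇒≥ r≮c) (<⇒≤ r<x))) p) ∷ map-suc-ascending ps

row-ascending : ∀ σ → Ascending (row σ)
row-ascending []      = []
row-ascending (c ∷ σ) = bump-ascending c (row-ascending σ)

bump-map-suc : ∀ c rs → bump (suc c) (map suc rs) ≡ map suc (bump c rs)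
bump-map-suc c []       = refl
bump-map-suc c (r ∷ rs) with r <? c
... | yes r<c = trans (bump-< (map suc rs) (s≤s r<c)) (cong (suc r ∷_) (bump-map-suc c rs))
... | no  r≮c = bump-≥ (map suc rs) (s≤s (≮⇒≥ r≮c))

-- Once c is in the row, a lands at or to the left of that entry and b to the right of it, so the
-- two insertions interfere only through the shift of ranks.
bump-yxz : ∀ {a b c} rs → a ≤ c → c < b →
  bump (suc b) (bump a (bump c rs)) ≡ bump a (bump b (bump c rs))
bump-yxz {a} {b} {c} [] a≤c c<b
  rewrite bump-≥ {a} {c} [] a≤c | bump-< {suc b} {a} [] (s≤s (≤-trans a≤c (<⇒≤ c<b)))
        | bump-< {b} {c} [] c<b | bump-≥ {a} {c} [ b ] a≤c = refl
bump-yxz {a} {b} {c} (r ∷ rs) a≤c c<b with r <? c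
... | no r≮c
  rewrite bump-≥ {a} {c} (map suc rs) a≤c | bump-< {suc b} {a} (map suc (map suc rs)) (s≤s (≤-trans a≤c (<⇒≤ c<b)))
        | bump-< {b} {c} (map suc rs) c<b | bump-≥ {a} {c} (bump b (map suc rs)) a≤c
        | bump-map-suc b (map suc rs) = refl
... | yes r<c with r <? a
...   | yes r<a
  rewrite bump-< {suc b} {r} (bump a (bump c rs)) (<-trans r<c (<-trans c<b (n<1+n b)))
        | bump-< {b} {r} (bump c rs) (<-trans r<c c<b)
        | bump-< {a} {r} (bump b (bump c rs)) r<a = cong (r ∷_) (bump-yxz rs a≤c c<b)
...   | no r≮a
  rewrite bump-< {suc b} {a} (map suc (bump c rs)) (s≤s (≤-trans a≤c (<⇒≤ c<b)))
        | bump-< {b} {r} (bump c rs) (<-trans r<c c<b)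
        | bump-≥ {a} {r} (bump b (bump c rs)) (≮⇒≥ r≮a)
        | bump-map-suc b (bump c rs) = refl

-- If some entry separates a from b, the two insertions again act at different cells. Otherwise a
-- bumps b when it comes second, and the two rows differ. Then d, which lies between the two
-- letters, enters the cell right of a in both rows and removes the difference.
bump-xzy : ∀ {a b d rs} → Ascending rs → a < d → d ≤ suc b → a ≤ b →
  bump d (bump (suc b) (bump a rs)) ≡ bump d (bump a (bump b rs))
bump-xzy {a} {b} {d} [] a<d d≤ a≤b
  rewrite bump-< {suc b} {a} [] (s≤s a≤b) | bump-< {d} {a} [ suc b ] a<d | bump-≥ {d} {suc b} [] d≤
        | bump-≥ {a} {b} [] a≤b | bump-< {d} {a} [] a<d = refl
bump-xzy {a} {b} {d} (_∷_ {r} {rs} p ps) a<d d≤ a≤b with r <? a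
... | yes r<a
  rewrite bump-< {suc b} {r} (bump a rs) (m<n⇒m<1+n (<-≤-trans r<a a≤b))
        | bump-< {b} {r} rs (<-≤-trans r<a a≤b) | bump-< {a} {r} (bump b rs) r<a
        | bump-< {d} {r} (bump (suc b) (bump a rs)) (<-trans r<a a<d)
        | bump-< {d} {r} (bump a (bump b rs)) (<-trans r<a a<d) = cong (r ∷_) (bump-xzy ps a<d d≤ a≤b)
... | no r≮a rewrite bump-< {suc b} {a} (map suc rs) (s≤s a≤b) | bump-map-suc b rs with r <? b
...   | yes r<b rewrite bump-≥ {a} {r} (bump b rs) (≮⇒≥ r≮a) = refl
...   | no r≮b
  rewrite bump-≥ {a} {b} (map suc rs) a≤b | bump-< {d} {a} (map suc (bump b rs)) a<d
        | bump-< {d} {a} (map suc (map suc rs)) a<d = cong (a ∷_) (tail rs p)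
  where
  tail : ∀ rs → All (r <_) rs → bump d (map suc (bump b rs)) ≡ bump d (map suc (map suc rs))
  tail []       _ = bump-≥ [] d≤
  tail (x ∷ xs) (r<x ∷ _)
    rewrite bump-≥ {b} {x} xs (≤-trans (≮⇒≥ r≮b) (<⇒≤ r<x))
          | bump-≥ {d} {suc b} (map suc (map suc xs)) d≤
          | bump-≥ {d} {suc (suc x)} (map suc (map suc xs))
              (≤-trans d≤ (s≤s (m≤n⇒m≤1+n (≤-trans (≮⇒≥ r≮b) (<⇒≤ r<x))))) = refl

row-plactic : ∀ {σ τ} → σ ~ τ → row σ ≡ row τ
row-plactic (yxz {ρ = ρ} a≤c c<b _)       = bump-yxz (row ρ) a≤c c<b
row-plactic (xzy {ρ = ρ} a<d d≤ a≤b _)    = bump-xzy (row-ascending ρ) a<d d≤ a≤b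
row-plactic (c ∷ r)                       = cong (bump c) (row-plactic r)

-- Deleting the maximum

-- The maximum is the last letter which exceeds everything before it; no other rank counts it.
delmax : List ℕ → List ℕ
delmax []      = []
delmax (c ∷ σ) with c <? length σ
... | yes _ = c ∷ delmax σ
... | no  _ = σ

delmax-< : ∀ {c} σ → c < length σ → delmax (c ∷ σ) ≡ c ∷ delmax σ
delmax-< {c} σ p with c <? length σ
... | yes _ = refl
... | no ¬p = contradiction p ¬p

delmax-≥ : ∀ {c} σ → length σ ≤ c → delmax (c ∷ σ) ≡ σ
delmax-≥ {c} σ p with c <? length σ
... | yes q = contradiction q (≤⇒≯ p)
... | no _  = refl

length-delmax : ∀ c σ → length (delmax (c ∷ σ)) ≡ length σ
length-delmax c σ with c <? length σ
length-delmax c (d ∷ σ) | yes _ = cong suc (length-delmax d σ)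
... | no _  = refl

delmax-valid : ∀ σ → Valid σ → Valid (delmax σ)
delmax-valid []      v = tt
delmax-valid (c ∷ σ) (c≤ , v) with c <? length σ
delmax-valid (c ∷ d ∷ σ) (_ , v) | yes c< = subst (c ≤_) (sym (length-delmax d σ)) (s≤s⁻¹ c<) , delmax-valid (d ∷ σ) v
... | no _  = v

row-< : ∀ σ → Valid σ → All (_< length σ) (row σ)
row-< []      v        = []
row-< (c ∷ σ) (c≤ , v) = go (row σ) (row-< σ v)
  where
  go : ∀ rs → All (_< length σ) rs → All (_< suc (length σ)) (bump c rs)
  go []       []       = s≤s c≤ ∷ []
  go (r ∷ rs) (p ∷ ps) with r <? c
  ... | yes _ = m<n⇒m<1+n p ∷ go rs ps
  ... | no  _ = s≤s c≤ ∷ AllP.map⁺ (All.map s≤s ps)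

bump-top : ∀ c rs → All (_< c) rs → bump c rs ≡ rs ++ [ c ]
bump-top c []       []       = refl
bump-top c (r ∷ rs) (p ∷ ps) = trans (bump-< rs p) (cong (r ∷_) (bump-top c rs ps))

-- The new letter either takes the cell of `l`, just as if that cell had been free, or bumps an
-- earlier entry and merely raises the rank of `l`. In neither case does the row grow.
bump-last : ∀ {c l} rs → c ≤ l →
  (bump c (rs ++ [ l ]) ≡ bump c rs ⊎ bump c (rs ++ [ l ]) ≡ bump c rs ++ [ suc l ]) ×
  length (bump c (rs ++ [ l ])) ≡ length (rs ++ [ l ])
bump-last {c} {l} [] c≤l rewrite bump-≥ {c} {l} [] c≤l = inj₁ refl , refl
bump-last {c} {l} (r ∷ rs) c≤l with r <? c | bump-last rs c≤l
... | yes _ | inj₁ e , len = inj₁ (cong (r ∷_) e) , cong suc len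
... | yes _ | inj₂ e , len = inj₂ (cong (r ∷_) e) , cong suc len
... | no _  | _            = inj₂ (cong (c ∷_) (map-++ suc rs [ l ])) , cong suc (length-map suc (rs ++ [ l ]))

-- The maximum enters at the end of the row. Later letters are smaller: they bump it or leave it
-- there, and the rest of the row is the same as without it.
row-delmax : ∀ c σ → Valid (c ∷ σ) →
  row (c ∷ σ) ≡ row (delmax (c ∷ σ)) ⊎ row (c ∷ σ) ≡ row (delmax (c ∷ σ)) ++ [ length σ ]
row-delmax c σ (c≤ , v) with c <? length σ
row-delmax c σ       (c≤ , v) | no c≮ with ≤-antisym c≤ (≮⇒≥ c≮)
... | refl = inj₂ (bump-top c (row σ) (row-< σ v))
row-delmax c (d ∷ σ) (c≤ , v) | yes c< with row-delmax d σ v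
... | inj₁ e = inj₁ (cong (bump c) e)
... | inj₂ e rewrite e = proj₁ (bump-last (row (delmax (d ∷ σ))) (s≤s⁻¹ c<))

-- No increasing subsequence contains both the new letter and the larger maximum before it, so each
-- is covered by one of the two bounds.
width-insert : ∀ {M} c d σ → Valid (d ∷ σ) → c ≤ length σ →
  width (d ∷ σ) ≤ M → width (c ∷ delmax (d ∷ σ)) ≤ M → width (c ∷ d ∷ σ) ≤ M
width-insert {M} c d σ v c≤ w w⁻ with row-delmax d σ v
... | inj₁ e = subst (λ x → length (bump c x) ≤ M) (sym e) w⁻
... | inj₂ e rewrite e = ≤-trans (≤-reflexive (proj₂ (bump-last (row (delmax (d ∷ σ))) c≤))) w

width-top : ∀ σ → Valid σ → width (length σ ∷ σ) ≡ suc (width σ)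
width-top σ v = trans (cong length (bump-top (length σ) (row σ) (row-< σ v)))
                      (trans (length-++ (row σ)) (+-comm (width σ) 1))

-- If the maximum is the letter z of the relation, deleting it makes the two words equal. Otherwise
-- it lies outside the three letters and the relation survives.
delmax-plactic : ∀ {σ τ} → σ ~ τ → delmax σ ≡ delmax τ ⊎ delmax σ ~ delmax τ
delmax-plactic (yxz {a} {b} {c} {ρ} a≤c c<b b≤)
  rewrite delmax-< {a} (b ∷ c ∷ ρ) (s≤s (≤-trans a≤c (≤-trans (<⇒≤ c<b) b≤)))
  with suc b <? suc (suc (length ρ)) | b <? suc (length ρ)
... | yes p | no ¬q = contradiction (s≤s⁻¹ p) ¬q
... | no ¬p | yes q = contradiction (s≤s q) ¬p
... | no _  | no _  = inj₁ refl
... | yes _ | yes q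
  rewrite delmax-< {a} (c ∷ ρ) (s≤s (≤-trans a≤c (s≤s⁻¹ (≤-trans c<b b≤))))
        | delmax-< {c} ρ (s≤s⁻¹ (≤-trans (s≤s c<b) q))
  with ρ
... | []     = contradiction (≤-trans c<b (s≤s⁻¹ q)) λ ()
... | e ∷ ρ′ = inj₂ (yxz a≤c c<b (subst (λ x → b ≤ suc x) (sym (length-delmax e ρ′)) (s≤s⁻¹ q)))
delmax-plactic (xzy {a} {b} {d} {ρ} a<d d≤ a≤b b≤)
  rewrite delmax-< {d} (suc b ∷ a ∷ ρ) (s≤s (≤-trans d≤ (s≤s b≤)))
        | delmax-< {d} (a ∷ b ∷ ρ) (s≤s (≤-trans d≤ (s≤s b≤)))
        | delmax-< {a} (b ∷ ρ) (s≤s (≤-trans a≤b b≤))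
  with suc b <? suc (length ρ) | b <? length ρ
... | yes p | no ¬q = contradiction (s≤s⁻¹ p) ¬q
... | no ¬p | yes q = contradiction (s≤s q) ¬p
... | no _  | no _  = inj₁ refl
... | yes _ | yes q rewrite delmax-< {a} ρ (≤-<-trans a≤b q) with ρ
... | e ∷ ρ′ = inj₂ (xzy a<d d≤ a≤b (subst (b ≤_) (sym (length-delmax e ρ′)) (s≤s⁻¹ q)))
delmax-plactic (_∷_ c {σ} {τ} r) with c <? length σ | c <? length τ
... | yes p | no ¬q = contradiction (subst (c <_) (~-length r) p) ¬q
... | no ¬p | yes q = contradiction (subst (c <_) (sym (~-length r)) q) ¬p
... | no _  | no _  = inj₂ r
... | yes _ | yes _ with delmax-plactic r
...   | inj₁ e = inj₁ (cong (c ∷_) e)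
...   | inj₂ e = inj₂ (c ∷ e)

-- Counting sweeps

-- The number of sweeps of length t from σ with m fixed points.
count       : ℕ → ℕ → ℕ → List ℕ → ℕ
afterOpen   : ℕ → ℕ → ℕ → List ℕ → ℕ
afterClose  : ℕ → ℕ → ℕ → List ℕ → ℕ
afterFix    : ℕ → ℕ → ℕ → List ℕ → ℕ

count M zero    zero    []      = 1
count M zero    zero    (_ ∷ _) = 0
count M zero    (suc m) σ       = 0
count M (suc t) m       σ       =
  gate (width σ ≤? M) (afterOpen M t m σ + (afterClose M t m σ + afterFix M t m σ))

afterOpen M t m []      = 0
afterOpen M t m (c ∷ σ) = count M t m (delmax (c ∷ σ))

afterClose M t m σ = sumFrom 0 (suc (length σ)) λ c → count M t m (c ∷ σ)

afterFix M t zero    σ = 0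
afterFix M t (suc m) σ = gate (width σ <? M) (count M t m σ)

count-wide : ∀ M t m σ → M < width σ → count M t m σ ≡ 0
count-wide M zero    zero    (c ∷ σ) w = refl
count-wide M zero    (suc m) σ       w = refl
count-wide M (suc t) m       σ       w = gate-no (width σ ≤? M) (<⇒≱ w)

-- Appending letters never shortens the row, so no extension of too wide a word is counted.
desc-wide : ∀ M t n B σ → M < width σ → desc n (λ _ → count M t 0) B σ ≡ 0
desc-wide M t zero    B σ w = count-wide M t 0 σ w
desc-wide M t (suc n) B σ w = sum-zero 0 (suc B) λ c _ _ →
  desc-wide M t n c (c ∷ σ) (<-≤-trans w (length-bump-≤ c (row σ)))

-- Each ingredient of the recursion respects the Knuth relations: the width by `row-plactic`, an
-- opener by `delmax-plactic`, a closer by the congruence rule of `_~_`. At time 0 both words are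
-- nonempty and count as 0.
count-plactic : ∀ M t → Plactic (count M t 0)
count-plactic M zero    (yxz _ _ _)   = refl
count-plactic M zero    (xzy _ _ _ _) = refl
count-plactic M zero    (c ∷ r)       = refl
count-plactic M (suc t) {σ} {τ} r = gate-cong (width σ ≤? M) (width τ ≤? M)
  (subst (_≤ M) w) (subst (_≤ M) (sym w))
  λ _ _ → cong₂ _+_ (open≡ σ τ (~-length r) open≡′) (cong (_+ 0) close≡)
  where
  w : width σ ≡ width τ
  w = cong length (row-plactic r)
  open≡′ : count M t 0 (delmax σ) ≡ count M t 0 (delmax τ)
  open≡′ with delmax-plactic r
  ... | inj₁ e = cong (count M t 0) e
  ... | inj₂ s = count-plactic M t s
  open≡ : ∀ σ τ → length σ ≡ length τ → count M t 0 (delmax σ) ≡ count M t 0 (delmax τ) →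
          afterOpen M t 0 σ ≡ afterOpen M t 0 τ
  open≡ (_ ∷ _) (_ ∷ _) _ e = e
  open≡ []      []      _ _ = refl
  close≡ : afterClose M t 0 σ ≡ afterClose M t 0 τ
  close≡ = trans (sum-cong 0 (suc (length σ)) λ c _ _ → count-plactic M t (c ∷ r))
                 (cong (λ k → sumFrom 0 (suc k) λ c → count M t 0 (c ∷ τ)) (~-length r))

-- Trading fixed points for decreasing runs

module _ (M t : ℕ) where

  open ≡-Reasoning

  private
    f opened closed : List ℕ → ℕ
    f          = count M t 0
    opened τ   = gate (width τ ≤? M) (afterOpen M t 0 τ)
    closed τ   = gate (width τ ≤? M) (afterClose M t 0 τ)

  -- If the run stays below the maximum of σ, deleting the maximum commutes with appending the run.
  desc-below-max : ∀ m B c σ → Valid (c ∷ σ) → B ≤ length σ →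
    desc m (λ _ → opened) B (c ∷ σ) ≡
    gate (width (c ∷ σ) ≤? M) (desc m (λ _ → f) B (delmax (c ∷ σ)))
  desc-below-max zero    B c σ v B≤ = refl
  desc-below-max (suc m) B c σ v B≤ = trans (sum-cong 0 (suc B) each)
    (sym (sum-gate (width (c ∷ σ) ≤? M) 0 (suc B) _))
    where
    each : ∀ d → 0 ≤ d → d < suc B →
      desc m (λ _ → opened) d (d ∷ c ∷ σ) ≡
      gate (width (c ∷ σ) ≤? M) (desc m (λ _ → f) d (d ∷ delmax (c ∷ σ)))
    each d _ d≤B = trans (desc-below-max m d d (c ∷ σ) (m≤n⇒m≤1+n d≤ , v) (m≤n⇒m≤1+n d≤)) eq
      where
      d≤ : d ≤ length σ
      d≤ = ≤-trans (s≤s⁻¹ d≤B) B≤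
      τ⁻ : List ℕ
      τ⁻ = d ∷ delmax (c ∷ σ)
      eq : gate (width (d ∷ c ∷ σ) ≤? M) (desc m (λ _ → f) d (delmax (d ∷ c ∷ σ))) ≡
           gate (width (c ∷ σ) ≤? M) (desc m (λ _ → f) d τ⁻)
      -- If `τ⁻` is too wide, both sides vanish by `desc-wide`. Otherwise `width-insert` makes the
      -- gates at `d ∷ c ∷ σ` and at `c ∷ σ` equivalent.
      eq rewrite delmax-< {d} (c ∷ σ) (s≤s d≤) with width τ⁻ ≤? M
      ... | yes w = gate-cong (width (d ∷ c ∷ σ) ≤? M) (width (c ∷ σ) ≤? M)
                      (≤-trans (length-bump-≤ d (row (c ∷ σ))))
                      (λ w′ → width-insert d c σ v d≤ w′ w) (λ _ _ → refl)
      ... | no w rewrite desc-wide M t m d τ⁻ (≰⇒> w) =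
                    trans (gate-zero (width (d ∷ c ∷ σ) ≤? M)) (sym (gate-zero (width (c ∷ σ) ≤? M)))

  module _ (ih : ∀ m σ → Valid σ → count M t m σ ≡ desc m (λ _ → f) (length σ) σ) where

    -- With rank `length σ` the first run letter is a new maximum. Deleting it gives back σ, while
    -- its presence raises the width by one, so the weak bound on the longer word is the strict
    -- bound required at a fixed point.
    desc-max : ∀ m σ → Valid σ →
      desc m (λ _ → opened) (length σ) (length σ ∷ σ) ≡
      gate (width σ ≤? M) (gate (width σ <? M) (count M t m σ))
    desc-max m σ v = begin
      desc m (λ _ → opened) (length σ) (length σ ∷ σ)
        ≡⟨ desc-below-max m (length σ) (length σ) σ (≤-refl , v) ≤-refl ⟩
      gate (width (length σ ∷ σ) ≤? M) (desc m (λ _ → f) (length σ) (delmax (length σ ∷ σ)))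
        ≡⟨ cong (λ x → gate (width (length σ ∷ σ) ≤? M) (desc m (λ _ → f) (length σ) x)) (delmax-≥ σ ≤-refl) ⟩
      gate (width (length σ ∷ σ) ≤? M) (desc m (λ _ → f) (length σ) σ)
        ≡⟨ gate-cong (width (length σ ∷ σ) ≤? M) (width σ <? M)
             (subst (_≤ M) (width-top σ v)) (subst (_≤ M) (sym (width-top σ v)))
             (λ _ _ → sym (ih m σ v)) ⟩
      gate (width σ <? M) (count M t m σ)
        ≡⟨ gate-absorb ⟩
      gate (width σ ≤? M) (gate (width σ <? M) (count M t m σ)) ∎
      where
      gate-absorb : gate (width σ <? M) (count M t m σ) ≡
                    gate (width σ ≤? M) (gate (width σ <? M) (count M t m σ))
      gate-absorb with width σ ≤? M
      ... | yes _ = refl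
      ... | no w  = gate-no (width σ <? M) (w ∘ <⇒≤)

    -- Nonempty runs that start with a new maximum give the fixed point term by `desc-max`. Those
    -- that start below the old maximum commute with its deletion and give the opener term.
    desc-opened : ∀ m σ → Valid σ →
      desc m (λ _ → opened) (length σ) σ ≡
      gate (width σ ≤? M) (afterOpen M t m σ + afterFix M t m σ)
    desc-opened zero    σ v = cong (gate (width σ ≤? M)) (sym (+-identityʳ _))
    desc-opened (suc m) σ v = trans (cong₂ _+_ (below σ v) (desc-max m σ v))
      (sym (gate-+ (width σ ≤? M) (afterOpen M t (suc m) σ) (afterFix M t (suc m) σ)))
      where
      below : ∀ σ → Valid σ → sumFrom 0 (length σ) (λ c → desc m (λ _ → opened) c (c ∷ σ)) ≡
              gate (width σ ≤? M) (afterOpen M t (suc m) σ)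
      below []      _ = sym (gate-zero (0 ≤? M))
      below (c ∷ σ) v = trans (desc-below-max (suc m) (length σ) c σ v ≤-refl)
        (cong (gate (width (c ∷ σ) ≤? M)) (trans
          (cong (λ k → desc (suc m) (λ _ → f) k (delmax (c ∷ σ))) (sym (length-delmax c σ)))
          (sym (ih (suc m) (delmax (c ∷ σ)) (delmax-valid (c ∷ σ) v)))))

    desc-closed : ∀ m σ → Valid σ →
      desc m (λ _ → closed) (length σ) σ ≡ gate (width σ ≤? M) (afterClose M t m σ)
    desc-closed m σ v = begin
      desc m (λ _ → closed) (length σ) σ
        ≡⟨ desc-cong m (length σ) σ (λ _ τ _ _ → ungate τ) ⟩
      desc m (λ _ τ → afterClose M t 0 τ) (length σ) σ
        ≡⟨ Exchange.exchange f (count-plactic M t) m σ ⟩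
      sumFrom 0 (suc (length σ)) (λ b → desc m (λ _ → f) (suc (length σ)) (b ∷ σ))
        ≡⟨ sum-cong 0 (suc (length σ)) (λ b _ b≤ → sym (ih m (b ∷ σ) (s≤s⁻¹ b≤ , v))) ⟩
      afterClose M t m σ
        ≡⟨ regate ⟩
      gate (width σ ≤? M) (afterClose M t m σ) ∎
      where
      vanish : ∀ m τ → ¬ width τ ≤ M → afterClose M t m τ ≡ 0
      vanish m τ w = sum-zero 0 (suc (length τ)) λ c _ _ →
        count-wide M t m (c ∷ τ) (<-≤-trans (≰⇒> w) (length-bump-≤ c (row τ)))
      ungate : ∀ τ → closed τ ≡ afterClose M t 0 τ
      ungate τ with width τ ≤? M
      ... | yes _ = refl
      ... | no w  = sym (vanish 0 τ w)
      regate : afterClose M t m σ ≡ gate (width σ ≤? M) (afterClose M t m σ)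
      regate with width σ ≤? M
      ... | yes _ = refl
      ... | no w  = vanish m σ w

-- By induction on `t`. From σ with a run appended, a sweep without fixed points starts with an
-- opener or a closer; `desc-opened` and `desc-closed` convert these two kinds of first step into
-- the three kinds possible from σ.
count-desc : ∀ M t m σ → Valid σ → count M t m σ ≡ desc m (λ _ → count M t 0) (length σ) σ
count-desc M zero zero    σ v = refl
-- The sweep of length 0 must be at the empty word, but a word with a nonempty run appended is not
-- empty.
count-desc M zero (suc m) σ v = sym (sum-zero 0 (suc (length σ)) λ c _ _ → vanish m c c σ)
  where
  vanish : ∀ m B c σ → desc m (λ _ → count M 0 0) B (c ∷ σ) ≡ 0
  vanish zero    B c σ = refl
  vanish (suc m) B c σ = sum-zero 0 (suc B) λ d _ _ → vanish m d d (c ∷ σ)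
count-desc M (suc t) m σ v = sym (begin
  desc m (λ _ → count M (suc t) 0) (length σ) σ
    ≡⟨ desc-cong m (length σ) σ (λ _ τ _ _ → trans
         (cong (λ x → gate (width τ ≤? M) (afterOpen M t 0 τ + x)) (+-identityʳ _))
         (gate-+ (width τ ≤? M) _ _)) ⟩
  desc m (λ _ τ → gate (width τ ≤? M) (afterOpen M t 0 τ) + gate (width τ ≤? M) (afterClose M t 0 τ)) (length σ) σ
    ≡⟨ desc-+ m _ _ (length σ) σ ⟩
  _ ≡⟨ cong₂ _+_ (desc-opened M t (count-desc M t) m σ v) (desc-closed M t (count-desc M t) m σ v) ⟩
  gate w (afterOpen M t m σ + afterFix M t m σ) + gate w (afterClose M t m σ)
    ≡⟨ sym (gate-+ w _ _) ⟩
  gate w ((afterOpen M t m σ + afterFix M t m σ) + afterClose M t m σ)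
    ≡⟨ cong (gate w) (trans (+-assoc (afterOpen M t m σ) _ _)
         (cong (afterOpen M t m σ +_) (+-comm (afterFix M t m σ) _))) ⟩
  count M (suc t) m σ ∎)
  where
  open ≡-Reasoning
  w : Dec (width σ ≤ M)
  w = width σ ≤? M

-- From the empty word with bound 0 all ranks of the run are 0, so the sum in `count-desc` has a
-- single term, at the decreasing word of length m.
count-open≡count-fixed : ∀ M n m → count M n m [] ≡ count M n 0 (replicate m 0)
count-open≡count-fixed M n m = trans (count-desc M n m [] tt)
  (trans (zeros m []) (cong (count M n 0) (++-identityʳ (replicate m 0))))
  where
  shift : ∀ m σ → replicate m 0 ++ 0 ∷ σ ≡ 0 ∷ (replicate m 0 ++ σ)
  shift zero    σ = refl
  shift (suc m) σ = cong (0 ∷_) (shift m σ)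
  zeros : ∀ m σ → desc m (λ _ → count M n 0) 0 σ ≡ count M n 0 (replicate m 0 ++ σ)
  zeros zero    σ = refl
  zeros (suc m) σ = trans (zeros m (0 ∷ σ)) (cong (count M n 0) (shift m σ))

-- Enumerations

-- `HasCount` over an arbitrary type; on `Perm n` the two agree by definition.
Card : {A : Set} → (A → Set) → ℕ → Set
Card {A} P k = Σ (List A) λ l → Unique l × ((x : A) → x ∈ l ⇔ P x) × length l ≡ k

card-unique : {A : Set} {P : A → Set} {k l : ℕ} → Card P k → Card P l → k ≡ l
card-unique (xs , ux , xs⇔P , refl) (ys , uy , ys⇔P , refl) =
  ↭-length (∼bag⇒↭ (unique∧set⇒bag ux uy λ {x} →
    mk⇔ (from (ys⇔P x) ∘ to (xs⇔P x)) (from (xs⇔P x) ∘ to (ys⇔P x))))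

card-empty : {A : Set} {P : A → Set} → (∀ x → ¬ P x) → Card P 0
card-empty ¬P = [] , [] , (λ x → mk⇔ (λ ()) (λ p → contradiction p (¬P x))) , refl

card-zero : {A : Set} {P : A → Set} → Card P 0 → ∀ x → ¬ P x
card-zero ([] , _ , l⇔P , _) x p with from (l⇔P x) p
... | ()

card-cong : {A : Set} {P Q : A → Set} {k : ℕ} → (∀ x → P x → Q x) → (∀ x → Q x → P x) → Card P k → Card Q k
card-cong f g (l , u , l⇔P , len) = l , u , (λ x → mk⇔ (f x ∘ to (l⇔P x)) (from (l⇔P x) ∘ g x)) , len

card-⊎ : {A : Set} {P Q : A → Set} {k l : ℕ} → (∀ x → P x → ¬ Q x) →
         Card P k → Card Q l → Card (λ x → P x ⊎ Q x) (k + l)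
card-⊎ {P = P} {Q} disjoint (xs , ux , xs⇔P , refl) (ys , uy , ys⇔Q , refl) =
  xs ++ ys ,
  UniqueP.++⁺ ux uy (λ {x} (x∈xs , x∈ys) → disjoint x (to (xs⇔P x) x∈xs) (to (ys⇔Q x) x∈ys)) ,
  (λ x → mk⇔ (split x) (join x)) ,
  length-++ xs
  where
  split : ∀ x → x ∈ xs ++ ys → P x ⊎ Q x
  split x x∈ with ∈-++⁻ xs x∈
  ... | inj₁ m = inj₁ (to (xs⇔P x) m)
  ... | inj₂ m = inj₂ (to (ys⇔Q x) m)
  join : ∀ x → P x ⊎ Q x → x ∈ xs ++ ys
  join x (inj₁ p) = ∈-++⁺ˡ (from (xs⇔P x) p)
  join x (inj₂ q) = ∈-++⁺ʳ xs (from (ys⇔Q x) q)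

card-image : {A B : Set} {P : A → Set} {k : ℕ} (f : A → B) → (∀ {x y} → f x ≡ f y → x ≡ y) →
             Card P k → Card (λ y → ∃ λ x → P x × y ≡ f x) k
card-image {P = P} f inj (l , u , l⇔P , refl) =
  map f l , UniqueP.map⁺ inj u ,
  (λ y → mk⇔ (λ m → let x , x∈l , eq = ∈-map⁻ f m in x , to (l⇔P x) x∈l , eq)
              (λ { (x , p , refl) → ∈-map⁺ f (from (l⇔P x) p) })) ,
  length-map f l

card-sum : {A : Set} {P : ℕ → A → Set} {g : ℕ → ℕ} → (∀ {c d x} → P c x → P d x → c ≡ d) →
           (∀ c → Card (P c) (g c)) → ∀ n → Card (λ x → ∃ λ c → c < n × P c x) (sumFrom 0 n g)
card-sum disjoint cards zero    = card-empty λ { x (c , () , _) }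
card-sum {P = P} disjoint cards (suc n) = card-cong
  (λ { x (inj₁ (c , c<n , p)) → c , m<n⇒m<1+n c<n , p ; x (inj₂ p) → n , n<1+n n , p })
  (λ x (c , c≤n , p) → last x c c≤n p)
  (card-⊎ (λ x (c , c<n , p) q → <⇒≢ c<n (disjoint p q)) (card-sum disjoint cards n) (cards n))
  where
  last : ∀ x c → c < suc n → P c x → (∃ λ c → c < n × P c x) ⊎ P n x
  last x c c≤n p with m≤n⇒m<n∨m≡n (s≤s⁻¹ c≤n)
  ... | inj₁ c<n  = inj₁ (c , c<n , p)
  ... | inj₂ refl = inj₂ p

-- `R` restricts to a bijection. It is a relation rather than a function because the coding of
-- involutions by words is given inductively.
card-transport : {A B : Set} {P : A → Set} {Q : B → Set} {R : A → B → Set} {k : ℕ} →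
  (∀ b → Q b → ∃ λ a → P a × R a b) → (∀ a → P a → ∃ λ b → Q b × R a b) →
  (∀ {a b b′} → P a → R a b → R a b′ → b ≡ b′) → (∀ {a a′ b} → P a → P a′ → R a b → R a′ b → a ≡ a′) →
  Card Q k → Card P k
card-transport {A} {B} {P} {Q} {R} total surj functional injective (bs , ub , bs⇔Q , refl) =
  as , unique paired ub , (λ a → mk⇔ (sound paired) (λ p → complete a p)) , Pointwise-length paired
  where
  lift : (bs : List B) → (∀ {b} → b ∈ bs → Q b) → ∃ λ as → Pointwise (λ a b → P a × R a b) as bs
  lift []       q = [] , []
  lift (b ∷ bs) q with total b (q (here refl)) | lift bs (q ∘ there)
  ... | a , pr | as , prs = a ∷ as , pr ∷ prs
  as : List A
  as = proj₁ (lift bs (λ {b} → to (bs⇔Q b)))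
  paired : Pointwise (λ a b → P a × R a b) as bs
  paired = proj₂ (lift bs (λ {b} → to (bs⇔Q b)))
  sound : ∀ {a as bs} → Pointwise (λ a b → P a × R a b) as bs → a ∈ as → P a
  sound ((p , _) ∷ _) (here refl) = p
  sound (_ ∷ prs)     (there m)   = sound prs m
  fresh : ∀ {a b as bs} → P a → R a b → All (b ≢_) bs → Pointwise (λ a b → P a × R a b) as bs → All (a ≢_) as
  fresh p r []       []             = []
  fresh p r (n ∷ ns) ((_ , r′) ∷ prs) = (λ { refl → n (functional p r r′) }) ∷ fresh p r ns prs
  unique : ∀ {as bs} → Pointwise (λ a b → P a × R a b) as bs → Unique bs → Unique as
  unique []               []       = []
  unique ((p , r) ∷ prs) (n ∷ u) = fresh p r n prs ∷ unique prs u
  find : ∀ {a b as bs} → P a → R a b → b ∈ bs → Pointwise (λ a b → P a × R a b) as bs → a ∈ as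
  find p r (here refl) ((p′ , r′) ∷ _) = here (injective p p′ r r′)
  find p r (there m)   (_ ∷ prs)       = there (find p r m prs)
  complete : ∀ a → P a → a ∈ as
  complete a p with surj a p
  ... | b , q , r = find p r (from (bs⇔Q b) q) paired

-- Sweeps as words of steps

data Step : Set where
  opn fix : Step
  cls     : ℕ → Step

Word : Set
Word = List Step

-- The sweeps counted by count.
data Good (M : ℕ) : ℕ → ℕ → List ℕ → Word → Set where
  done : Good M 0 0 [] []
  opn  : ∀ {t m c σ w} → width (c ∷ σ) ≤ M → Good M t m (delmax (c ∷ σ)) w →
         Good M (suc t) m (c ∷ σ) (opn ∷ w)
  cls  : ∀ {t m c σ w} → width σ ≤ M → c ≤ length σ → Good M t m (c ∷ σ) w →
         Good M (suc t) m σ (cls c ∷ w)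
  fix  : ∀ {t m σ w} → width σ < M → Good M t m σ w → Good M (suc t) (suc m) σ (fix ∷ w)

good-card : ∀ M t m σ → Card (Good M t m σ) (count M t m σ)
good-card M zero zero    []      = [ [] ] , [] ∷ [] ,
  (λ w → mk⇔ (λ { (here refl) → done }) (λ { done → here refl })) , refl
good-card M zero zero    (_ ∷ _) = card-empty λ { w () }
good-card M zero (suc m) σ       = card-empty λ { w () }
good-card M (suc t) m σ with width σ ≤? M
... | no ¬w = card-empty λ { w (opn w≤ _)   → ¬w w≤
                           ; w (cls w≤ _ _) → ¬w w≤
                           ; w (fix w< _)   → ¬w (<⇒≤ w<) }
... | yes w≤ = card-cong back forth
  (card-⊎ (λ { x ox (inj₁ cx) → open≢close ox cx ; x ox (inj₂ fx) → open≢fix σ m ox fx })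
    (opened σ)
    (card-⊎ (close≢fix m) closed (fixed m)))
  where
  Opened : List ℕ → Word → Set
  Opened []      x = ⊥
  Opened (c ∷ σ) x = ∃ λ w → Good M t m (delmax (c ∷ σ)) w × x ≡ opn ∷ w
  Closed : Word → Set
  Closed x = ∃ λ c → c < suc (length σ) × (∃ λ w → Good M t m (c ∷ σ) w × x ≡ cls c ∷ w)
  Fixed : ℕ → Word → Set
  Fixed zero    x = ⊥
  Fixed (suc m) x = width σ < M × ∃ λ w → Good M t m σ w × x ≡ fix ∷ w

  opened : ∀ σ → Card (Opened σ) (afterOpen M t m σ)
  opened []      = card-empty λ { x () }
  opened (c ∷ σ) = card-image (opn ∷_) (proj₂ ∘ ∷-injective) (good-card M t m (delmax (c ∷ σ)))
  closed : Card Closed (afterClose M t m σ)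
  closed = card-sum (λ { (_ , _ , refl) (_ , _ , refl) → refl })
    (λ c → card-image (cls c ∷_) (proj₂ ∘ ∷-injective) (good-card M t m (c ∷ σ))) (suc (length σ))
  fixed : ∀ m → Card (Fixed m) (afterFix M t m σ)
  fixed zero    = card-empty λ { x () }
  fixed (suc m) with width σ <? M
  ... | no ¬w = card-empty λ { x (w , _) → ¬w w }
  ... | yes w = card-cong (λ x p → w , p) (λ x → proj₂)
                  (card-image (fix ∷_) (proj₂ ∘ ∷-injective) (good-card M t m σ))

  open≢close : ∀ {σ x} → Opened σ x → ¬ Closed x
  open≢close {_ ∷ _} (_ , _ , refl) (_ , _ , _ , _ , ())
  open≢fix : ∀ σ m {x} → Opened σ x → ¬ Fixed m x
  open≢fix (_ ∷ _) (suc m) (_ , _ , refl) (_ , _ , _ , ())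
  close≢fix : ∀ m x → Closed x → ¬ Fixed m x
  close≢fix (suc m) x (_ , _ , _ , _ , refl) (_ , _ , _ , ())

  back : ∀ x → Opened σ x ⊎ (Closed x ⊎ Fixed m x) → Good M (suc t) m σ x
  back x (inj₁ o) = bo σ w≤ o
    where
    bo : ∀ σ → width σ ≤ M → Opened σ x → Good M (suc t) m σ x
    bo (c ∷ σ) w≤ (w , g , refl) = opn w≤ g
  back x (inj₂ (inj₁ (c , c≤ , w , g , refl))) = cls w≤ (s≤s⁻¹ c≤) g
  back x (inj₂ (inj₂ f)) = bf m f
    where
    bf : ∀ m → Fixed m x → Good M (suc t) m σ x
    bf (suc m) (w< , w , g , refl) = fix w< g
  forth : ∀ x → Good M (suc t) m σ x → Opened σ x ⊎ (Closed x ⊎ Fixed m x)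
  forth _ (opn _ g)    = inj₁ (_ , g , refl)
  forth _ (cls _ c≤ g) = inj₂ (inj₁ (_ , s≤s c≤ , _ , g , refl))
  forth _ (fix w< g)   = inj₂ (inj₂ (w< , _ , g , refl))

-- Sweeps of involutions

rank : ℕ → List ℕ → ℕ
rank x []      = 0
rank x (y ∷ p) = gate (y <? x) 1 + rank x p

code : List ℕ → List ℕ
code []      = []
code (x ∷ p) = rank x p ∷ code p

length-code : ∀ p → length (code p) ≡ length p
length-code []      = refl
length-code (x ∷ p) = cong suc (length-code p)

rank-∷-< : ∀ {x y} p → y < x → rank x (y ∷ p) ≡ suc (rank x p)
rank-∷-< {x} {y} p y<x = cong (_+ rank x p) (gate-yes (y <? x) y<x)

rank-∷-≥ : ∀ {x y} p → x ≤ y → rank x (y ∷ p) ≡ rank x p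
rank-∷-≥ {x} {y} p x≤y = cong (_+ rank x p) (gate-no (y <? x) (≤⇒≯ x≤y))

rank≤length : ∀ x p → rank x p ≤ length p
rank≤length x []      = z≤n
rank≤length x (y ∷ p) with y <? x
... | yes _ = s≤s (rank≤length x p)
... | no  _ = m≤n⇒m≤1+n (rank≤length x p)

rank-top : ∀ {t} p → All (_< t) p → rank t p ≡ length p
rank-top []      []         = refl
rank-top (y ∷ p) (y<t ∷ ps) = trans (rank-∷-< p y<t) (cong suc (rank-top p ps))

code-valid : ∀ p → Valid (code p)
code-valid []      = tt
code-valid (x ∷ p) = subst (rank x p ≤_) (sym (length-code p)) (rank≤length x p) , code-valid p

-- An opener may stand anywhere in the word, although it exceeds all other pending letters. By
-- `delmax-code`, `delmax` undoes the insertion.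
data Insert (t : ℕ) : List ℕ → List ℕ → Set where
  here  : ∀ {p} → Insert t p (t ∷ p)
  there : ∀ {x p q} → Insert t p q → Insert t (x ∷ p) (x ∷ q)

insert-new : ∀ {t p q} → Insert t p q → t ∈ q
insert-new here      = here refl
insert-new (there i) = there (insert-new i)

insert-old : ∀ {t p q x} → Insert t p q → x ∈ p → x ∈ q
insert-old here      m           = there m
insert-old (there i) (here refl) = here refl
insert-old (there i) (there m)   = there (insert-old i m)

insert-cases : ∀ {t p q x} → Insert t p q → x ∈ q → x ≡ t ⊎ x ∈ p
insert-cases here      (here refl) = inj₁ refl
insert-cases here      (there m)   = inj₂ m
insert-cases (there i) (here refl) = inj₂ (here refl)
insert-cases (there i) (there m) with insert-cases i m
... | inj₁ e  = inj₁ e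
... | inj₂ m′ = inj₂ (there m′)

insert-pairs : ∀ {R : ℕ → ℕ → Set} {t p q} → Insert t p q → AllPairs R q → AllPairs R p
insert-pairs here      (_ ∷ ps) = ps
insert-pairs (there i) (r ∷ ps) = All.tabulate (λ m → All.lookup r (insert-old i m)) ∷ insert-pairs i ps

insert-unique : ∀ {t p q} → Insert t p q → All (_< t) p → Unique p → Unique q
insert-unique here      b       u        = All.map (λ x<t t≡x → <⇒≢ x<t (sym t≡x)) b ∷ u
insert-unique {t} (there {x} i) (x<t ∷ b) (n ∷ u) =
  All.tabulate (λ m → fresh (insert-cases i m)) ∷ insert-unique i b u
  where
  fresh : ∀ {y} → y ≡ t ⊎ y ∈ _ → x ≢ y
  fresh (inj₁ refl) = <⇒≢ x<t
  fresh (inj₂ m)    = All.lookup n m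

insert-remove : ∀ {t q} → t ∈ q → ∃ λ p → Insert t p q
insert-remove (here refl)   = _ , here
insert-remove (there m) with insert-remove m
... | _ , i = _ , there i

insert-length : ∀ {t p q} → Insert t p q → length q ≡ suc (length p)
insert-length here      = refl
insert-length (there i) = cong suc (insert-length i)

rank-insert : ∀ {t x p q} → Insert t p q → x < t → rank x q ≡ rank x p
rank-insert {p = p} here x<t = rank-∷-≥ p (<⇒≤ x<t)
rank-insert {x = x} (there {y} i) x<t = cong (gate (y <? x) 1 +_) (rank-insert i x<t)

delmax-code : ∀ {t p q} → Insert t p q → All (_< t) p → delmax (code q) ≡ code p
delmax-code {t} {p} here b =
  delmax-≥ (code p) (≤-reflexive (trans (length-code p) (sym (rank-top p b))))
delmax-code (there {x} {p} {q} i) (x<t ∷ b) = trans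
  (delmax-< (code q) (subst₂ _<_ (sym (rank-insert i x<t))
    (sym (trans (length-code q) (insert-length i))) (s≤s (rank≤length x p))))
  (cong₂ _∷_ (rank-insert i x<t) (delmax-code i b))

insert-code-injective : ∀ {t p q r} → Insert t p q → Insert t p r → All (_< t) p → code q ≡ code r → q ≡ r
insert-code-injective here here b e = refl
insert-code-injective {t} here (there {x} {p} {r} i) b@(x<t ∷ _) e =
  contradiction (trans (sym (rank-top (x ∷ p) b)) (trans (∷-injectiveˡ e) (rank-insert i x<t)))
                (>⇒≢ (s≤s (rank≤length x p)))
insert-code-injective {t} (there {x} {p} i) here b@(x<t ∷ _) e =
  contradiction (trans (sym (rank-top (x ∷ p) b)) (trans (sym (∷-injectiveˡ e)) (rank-insert i x<t)))
                (>⇒≢ (s≤s (rank≤length x p)))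
insert-code-injective (there {x} i) (there j) (_ ∷ b) e = cong (x ∷_) (insert-code-injective i j b (∷-injectiveʳ e))

-- The ranks reveal where the maximum belongs: at the first entry of the list which counts all
-- entries behind it.
insert-with-code : ∀ {t} p c σ → All (_< t) p → Valid (c ∷ σ) → code p ≡ delmax (c ∷ σ) →
                   ∃ λ q → Insert t p q × code q ≡ c ∷ σ
insert-with-code {t} p c σ b (c≤ , v) e with c <? length σ
insert-with-code {t} p c σ b (c≤ , v) e | no c≮ = t ∷ p , here ,
  cong₂ _∷_ (trans (rank-top p b) (trans (sym (length-code p)) (trans (cong length e) (≤-antisym (≮⇒≥ c≮) c≤)))) e
insert-with-code {t} (x ∷ p) c (d ∷ σ) (x<t ∷ b) (c≤ , v) e | yes c<
  with insert-with-code p d σ b v (∷-injectiveʳ e)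
... | q , i , e′ = x ∷ q , there i , cong₂ _∷_ (trans (rank-insert i x<t) (∷-injectiveˡ e)) e′

-- The sweep w of the points below t of the involution f, where p lists the openers which are
-- still pending at t, latest letter first; f is only inspected outside p.
data Enc (f : ℕ → ℕ) : ℕ → List ℕ → Word → Set where
  done : Enc f 0 [] []
  opn  : ∀ {t p q w} → Insert t p q → Enc f t p w → Enc f (suc t) q (opn ∷ w)
  fix  : ∀ {t p w} → f t ≡ t → Enc f t p w → Enc f (suc t) p (fix ∷ w)
  cls  : ∀ {t j p c w} → f t ≡ j → f j ≡ t → c ≡ rank j p → Enc f t (j ∷ p) w →
         Enc f (suc t) p (cls c ∷ w)

enc-< : ∀ {f t p w} → Enc f t p w → All (_< t) p
enc-< done           = []
enc-< (opn i e)      = All.tabulate λ m → bound (insert-cases i m)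
  where
  bound : ∀ {x} → x ≡ _ ⊎ x ∈ _ → x < suc _
  bound (inj₁ refl) = n<1+n _
  bound (inj₂ m)    = m<n⇒m<1+n (All.lookup (enc-< e) m)
enc-< (fix _ e)      = All.map m<n⇒m<1+n (enc-< e)
enc-< (cls _ _ _ e)  = All.map m<n⇒m<1+n (All.tail (enc-< e))

enc-unique : ∀ {f t p w} → Enc f t p w → Unique p
enc-unique done          = []
enc-unique (opn i e)     = insert-unique i (enc-< e) (enc-unique e)
enc-unique (fix _ e)     = enc-unique e
enc-unique (cls _ _ _ e) = AllPairs.tail (enc-unique e)

∉-∷ : ∀ {x y : ℕ} {p} → x ≢ y → x ∉ p → x ∉ y ∷ p
∉-∷ x≢y x∉p (here e)  = x≢y e
∉-∷ x≢y x∉p (there m) = x∉p m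

top∉ : ∀ {t p} → All (_< t) p → t ∉ p
top∉ b m = <-irrefl refl (All.lookup b m)

MatchedBelow : (ℕ → ℕ) → ℕ → List ℕ → Set
MatchedBelow f t p = ∀ i → i < t → i ∉ p → f i < t × f i ∉ p × f (f i) ≡ i

enc-matched : ∀ {f t p w} → Enc f t p w → MatchedBelow f t p
enc-matched {f} {suc t} (opn {p = p} {q} ins e) i i≤t i∉q with m≤n⇒m<n∨m≡n (s≤s⁻¹ i≤t)
... | inj₂ refl = contradiction (insert-new ins) i∉q
... | inj₁ i<t with enc-matched e i i<t (i∉q ∘ insert-old ins)
...   | fi<t , fi∉p , ffi = m<n⇒m<1+n fi<t , away ∘ insert-cases ins , ffi
  where
  away : ¬ (f i ≡ t ⊎ f i ∈ p)
  away (inj₁ fi≡t) = <⇒≢ fi<t fi≡t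
  away (inj₂ m)    = fi∉p m
enc-matched {f} {suc t} (fix ft e) i i≤t i∉p with m≤n⇒m<n∨m≡n (s≤s⁻¹ i≤t)
... | inj₂ refl = subst (_< suc i) (sym ft) (n<1+n i) , subst (_∉ _) (sym ft) i∉p , trans (cong f ft) ft
... | inj₁ i<t with enc-matched e i i<t i∉p
...   | fi<t , fi∉p , ffi = m<n⇒m<1+n fi<t , fi∉p , ffi
enc-matched {f} {suc t} (cls {j = j} ft fj _ e) i i≤t i∉p
  with m≤n⇒m<n∨m≡n (s≤s⁻¹ i≤t) | enc-unique e
... | inj₂ refl | n ∷ _ =
  subst (_< suc i) (sym ft) (m<n⇒m<1+n (All.head (enc-< e))) ,
  (λ m → All.lookup n m (sym ft)) , trans (cong f ft) fj
... | inj₁ i<t | n ∷ _ with i ≟ j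
...   | yes refl = subst (_< suc t) (sym fj) (n<1+n t) ,
                   subst (_∉ _) (sym fj) (top∉ (All.tail (enc-< e))) , trans (cong f fj) ft
...   | no i≢j with enc-matched e i i<t (∉-∷ i≢j i∉p)
...     | fi<t , fi∉ , ffi = m<n⇒m<1+n fi<t , fi∉ ∘ there , ffi

enc-cong : ∀ {f g t p w} → Enc f t p w → (∀ i → i < t → i ∉ p → f i ≡ g i) → Enc g t p w
enc-cong done eq = done
enc-cong {t = suc t} (opn ins e) eq = opn ins (enc-cong e λ i i<t i∉p → eq i (m<n⇒m<1+n i<t) λ m →
  away i<t i∉p (insert-cases ins m))
  where
  away : ∀ {i p} → i < t → i ∉ p → ¬ (i ≡ t ⊎ i ∈ p)
  away i<t i∉p (inj₁ refl) = <-irrefl refl i<t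
  away i<t i∉p (inj₂ m)    = i∉p m
enc-cong {t = suc t} (fix ft e) eq =
  fix (trans (sym (eq t (n<1+n t) (top∉ (enc-< e)))) ft)
      (enc-cong e λ i i<t i∉p → eq i (m<n⇒m<1+n i<t) i∉p)
enc-cong {t = suc t} (cls {j = j} ft fj r e) eq with enc-unique e
... | n ∷ _ =
  cls (trans (sym (eq t (n<1+n t) (top∉ (All.tail (enc-< e))))) ft)
      (trans (sym (eq j (m<n⇒m<1+n (All.head (enc-< e))) λ m → All.lookup n m refl)) fj) r
      (enc-cong e λ i i<t i∉ → eq i (m<n⇒m<1+n i<t) (i∉ ∘ there))

enc-functional : ∀ {f t p w w′} → Enc f t p w → Enc f t p w′ → w ≡ w′
enc-functional done done = refl
enc-functional (opn i e) (opn i′ e′) = cong (opn ∷_) (enc-functional e (subst (λ p → Enc _ _ p _) (same i i′ (enc-< e) (enc-< e′)) e′))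
  where
  same : ∀ {t p p′ q} → Insert t p q → Insert t p′ q → All (_< t) p → All (_< t) p′ → p′ ≡ p
  same here       here       b       b′      = refl
  same here       (there j)  b       (t<t ∷ _) = contradiction t<t (<-irrefl refl)
  same (there i)  here       (t<t ∷ _) b′    = contradiction t<t (<-irrefl refl)
  same (there {x} i) (there j) (_ ∷ b) (_ ∷ b′) = cong (x ∷_) (same i j b b′)
enc-functional (opn i e) (fix _ e′) = contradiction (insert-new i) (top∉ (enc-< e′))
enc-functional (opn i e) (cls _ _ _ e′) = contradiction (insert-new i) (top∉ (All.tail (enc-< e′)))
enc-functional (fix _ e) (opn i e′) = contradiction (insert-new i) (top∉ (enc-< e))
enc-functional (fix _ e) (fix _ e′) = cong (fix ∷_) (enc-functional e e′)
enc-functional (fix ft e) (cls ft′ _ _ e′) = contradiction (trans (sym ft′) ft) (<⇒≢ (All.head (enc-< e′)))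
enc-functional (cls _ _ _ e) (opn i e′) = contradiction (insert-new i) (top∉ (All.tail (enc-< e)))
enc-functional (cls ft′ _ _ e′) (fix ft e) = contradiction (trans (sym ft′) ft) (<⇒≢ (All.head (enc-< e′)))
enc-functional (cls refl _ refl e) (cls refl _ refl e′) = cong (cls _ ∷_) (enc-functional e e′)

-- The step at `t` is forced: an opener if `t` is pending, a fixed point if `f t ≡ t`, and otherwise
-- a closer, whose partner `f t` becomes pending.
encode : ∀ f t p → All (_< t) p → Unique p → MatchedBelow f t p → ∃ (Enc f t p)
encode f zero    []      b        u matched = [] , done
encode f zero    (_ ∷ _) (() ∷ _) u matched
encode f (suc t) p       b        u matched with t ∈? p
... | yes t∈p with insert-remove t∈p
...   | p′ , ins = _ , opn ins (proj₂ (encode f t p′ b′ (insert-pairs ins u) matched′))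
  where
  t∉p′ : ∀ {p q} → Insert t p q → Unique q → t ∉ p
  t∉p′ here      (n ∷ _) m           = All.lookup n m refl
  t∉p′ (there i) (n ∷ _) (here refl) = All.lookup n (insert-new i) refl
  t∉p′ (there i) (_ ∷ u) (there m)   = t∉p′ i u m
  b′ : All (_< t) p′
  b′ = All.tabulate λ m → ≤∧≢⇒< (s≤s⁻¹ (All.lookup b (insert-old ins m))) λ { refl → t∉p′ ins u m }
  matched′ : MatchedBelow f t p′
  matched′ i i<t i∉p′ with matched i (m<n⇒m<1+n i<t) (λ m → away (insert-cases ins m))
    where
    away : ¬ (i ≡ t ⊎ i ∈ p′)
    away (inj₁ refl) = <-irrefl refl i<t
    away (inj₂ m)    = i∉p′ m
  ... | fi≤t , fi∉p , ffi = ≤∧≢⇒< (s≤s⁻¹ fi≤t) (λ e → fi∉p (subst (_∈ p) (sym e) t∈p)) ,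
                            fi∉p ∘ insert-old ins , ffi
encode f (suc t) p b u matched | no t∉p with f t ≟ t
... | yes ft = _ , fix ft (proj₂ (encode f t p b′ u matched′))
  where
  b′ : All (_< t) p
  b′ = All.tabulate λ m → ≤∧≢⇒< (s≤s⁻¹ (All.lookup b m)) λ { refl → t∉p m }
  matched′ : MatchedBelow f t p
  matched′ i i<t i∉p with matched i (m<n⇒m<1+n i<t) i∉p
  ... | fi≤t , fi∉p , ffi = ≤∧≢⇒< (s≤s⁻¹ fi≤t)
          (λ e → <⇒≢ i<t (trans (sym ffi) (trans (cong f e) ft))) , fi∉p , ffi
... | no ft≢t with matched t (n<1+n t) t∉p
...   | ft≤t , ft∉p , fft = _ , cls refl fft refl
          (proj₂ (encode f t (f t ∷ p) (≤∧≢⇒< (s≤s⁻¹ ft≤t) ft≢t ∷ b′)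
            (All.tabulate (λ m e → ft∉p (subst (_∈ p) (sym e) m)) ∷ u) matched′))
  where
  b′ : All (_< t) p
  b′ = All.tabulate λ m → ≤∧≢⇒< (s≤s⁻¹ (All.lookup b m)) λ { refl → t∉p m }
  matched′ : MatchedBelow f t (f t ∷ p)
  matched′ i i<t i∉ with matched i (m<n⇒m<1+n i<t) (i∉ ∘ there)
  ... | fi≤t , fi∉p , ffi =
    ≤∧≢⇒< (s≤s⁻¹ fi≤t) (λ e → i∉ (here (trans (sym ffi) (cong f e)))) ,
    ∉-∷ (λ e → <⇒≢ i<t (trans (sym ffi) (trans (cong f e) fft))) fi∉p , ffi

-- Adds the arc between `j` and `t`; for `j ≡ t` it adds a fixed point.
link : (ℕ → ℕ) → ℕ → ℕ → ℕ → ℕ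
link f j t i with i ≟ j | i ≟ t
... | yes _ | _     = t
... | no _  | yes _ = j
... | no _  | no _  = f i

link-left : ∀ f j t → link f j t j ≡ t
link-left f j t with j ≟ j
... | yes _ = refl
... | no ¬e = contradiction refl ¬e

link-right : ∀ f j t → j ≢ t → link f j t t ≡ j
link-right f j t j≢t with t ≟ j | t ≟ t
... | yes e | _     = contradiction (sym e) j≢t
... | no _  | yes _ = refl
... | no _  | no ¬e = contradiction refl ¬e

link-other : ∀ f j t i → i ≢ j → i ≢ t → f i ≡ link f j t i
link-other f j t i i≢j i≢t with i ≟ j | i ≟ t
... | yes e | _     = contradiction e i≢j
... | no _  | yes e = contradiction e i≢t
... | no _  | no _  = refl

decode : ∀ {M t m σ w} → Good M t m σ w → Valid σ → ∃ λ f → ∃ λ p → Enc f t p w × code p ≡ σ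
decode done v = id , [] , done , refl
decode (opn {c = c} {σ} _ g) v with decode g (delmax-valid (c ∷ σ) v)
... | f , p , e , eq with insert-with-code p c σ (enc-< e) v eq
...   | q , ins , eq′ = f , q , opn ins e , eq′
decode (fix {t} _ g) v with decode g v
... | f , p , e , eq = link f t t , p ,
  fix (link-left f t t) (enc-cong e λ i i<t _ → link-other f t t i (<⇒≢ i<t) (<⇒≢ i<t)) , eq
decode (cls {t} _ c≤ g) v with decode g (c≤ , v)
... | f , j ∷ p , e , refl = link f j t , p ,
  cls (link-right f j t (<⇒≢ (All.head (enc-< e)))) (link-left f j t) refl
      (enc-cong e λ i i<t i∉ → link-other f j t i (i∉ ∘ here) (<⇒≢ i<t)) , refl

-- Equality of the codes passes down to time 0, where both lists are empty. On the way back up, the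
-- word and the codes restore the pending letters and the partner of every settled point.
enc-injective : ∀ {f g t p q w} → Enc f t p w → Enc g t q w → code p ≡ code q →
                p ≡ q × (∀ i → i < t → i ∉ p → f i ≡ g i)
enc-injective done done _ = refl , λ _ ()
enc-injective {f} {g} {suc t} {p} (opn ins e) (opn ins′ e′) eq
  with enc-injective e e′ (trans (sym (delmax-code ins (enc-< e))) (trans (cong delmax eq) (delmax-code ins′ (enc-< e′))))
... | refl , agree = insert-code-injective ins ins′ (enc-< e) eq , agree′
  where
  agree′ : ∀ i → i < suc t → i ∉ p → f i ≡ g i
  agree′ i i≤t i∉p with m≤n⇒m<n∨m≡n (s≤s⁻¹ i≤t)
  ... | inj₁ i<t  = agree i i<t (i∉p ∘ insert-old ins)
  ... | inj₂ refl = contradiction (insert-new ins) i∉p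
enc-injective {f} {g} {suc t} {p} (fix ft e) (fix gt e′) eq with enc-injective e e′ eq
... | refl , agree = refl , agree′
  where
  agree′ : ∀ i → i < suc t → i ∉ p → f i ≡ g i
  agree′ i i≤t i∉p with m≤n⇒m<n∨m≡n (s≤s⁻¹ i≤t)
  ... | inj₁ i<t  = agree i i<t i∉p
  ... | inj₂ refl = trans ft (sym gt)
enc-injective {f} {g} {suc t} {p} (cls {j = j} ft fj c e) (cls gt gj c′ e′) eq
  with enc-injective e e′ (cong₂ _∷_ (trans (sym c) c′) eq)
... | refl , agree = refl , agree′
  where
  agree′ : ∀ i → i < suc t → i ∉ p → f i ≡ g i
  agree′ i i≤t i∉p with m≤n⇒m<n∨m≡n (s≤s⁻¹ i≤t)
  ... | inj₂ refl = trans ft (sym gt)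
  ... | inj₁ i<t with i ≟ j
  ...   | yes refl = trans fj (sym gj)
  ...   | no i≢j   = agree i i<t (∉-∷ i≢j i∉p)

fixes : Word → ℕ
fixes []          = 0
fixes (opn ∷ w)   = fixes w
fixes (cls _ ∷ w) = fixes w
fixes (fix ∷ w)   = suc (fixes w)

good-fixes : ∀ {M t m σ w} → Good M t m σ w → fixes w ≡ m
good-fixes done        = refl
good-fixes (opn _ g)   = good-fixes g
good-fixes (cls _ _ g) = good-fixes g
good-fixes (fix _ g)   = cong suc (good-fixes g)

fixes-card : ∀ {f t p w} → Enc f t p w → Card (λ i → i < t × i ∉ p × f i ≡ i) (fixes w)
fixes-card done = card-empty λ { i (() , _) }
fixes-card {f} {suc t} {q} (opn {p = p} ins e) = card-cong
  (λ { i (i<t , i∉p , fi) → m<n⇒m<1+n i<t , (λ m → away i<t i∉p (insert-cases ins m)) , fi })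
  back (fixes-card e)
  where
  away : ∀ {i} → i < t → i ∉ p → ¬ (i ≡ t ⊎ i ∈ p)
  away i<t i∉p (inj₁ refl) = <-irrefl refl i<t
  away i<t i∉p (inj₂ m)    = i∉p m
  back : ∀ i → i < suc t × i ∉ q × f i ≡ i → i < t × i ∉ p × f i ≡ i
  back i (i≤t , i∉q , fi) with m≤n⇒m<n∨m≡n (s≤s⁻¹ i≤t)
  ... | inj₁ i<t  = i<t , i∉q ∘ insert-old ins , fi
  ... | inj₂ refl = contradiction (insert-new ins) i∉q
fixes-card {f} {suc t} {p} (cls {j = j} ft fj _ e) = card-cong
  (λ { i (i<t , i∉ , fi) → m<n⇒m<1+n i<t , i∉ ∘ there , fi })
  back (fixes-card e)
  where
  j<t : j < t
  j<t = All.head (enc-< e)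
  back : ∀ i → i < suc t × i ∉ p × f i ≡ i → i < t × i ∉ j ∷ p × f i ≡ i
  back i (i≤t , i∉p , fi) with m≤n⇒m<n∨m≡n (s≤s⁻¹ i≤t)
  ... | inj₁ i<t  = i<t , ∉-∷ (λ { refl → <⇒≢ i<t (trans (sym fi) fj) }) i∉p , fi
  ... | inj₂ refl = contradiction (trans (sym ft) fi) (<⇒≢ j<t)
fixes-card {f} {suc t} {p} (fix {w = w} ft e) = subst (Card _) (+-comm (fixes w) 1) (card-cong
  (λ { i (inj₁ (i<t , r)) → m<n⇒m<1+n i<t , r ; i (inj₂ refl) → n<1+n t , top∉ (enc-< e) , ft })
  back
  (card-⊎ (λ { i (i<t , _) refl → <-irrefl refl i<t }) (fixes-card e)
    ([ t ] , [] ∷ [] , (λ i → mk⇔ (λ { (here e) → e }) here) , refl)))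
  where
  back : ∀ i → i < suc t × i ∉ p × f i ≡ i → (i < t × i ∉ p × f i ≡ i) ⊎ i ≡ t
  back i (i≤t , r) with m≤n⇒m<n∨m≡n (s≤s⁻¹ i≤t)
  ... | inj₁ i<t  = inj₁ (i<t , r)
  ... | inj₂ i≡t  = inj₂ i≡t

-- Increasing subsequences and nestings

-- Row insertion of the letters themselves, where `bump` works with ranks; `row-code` compares the
-- two.
place : ℕ → List ℕ → List ℕ
place x []       = [ x ]
place x (r ∷ rs) with r <? x
... | yes _ = r ∷ place x rs
... | no  _ = x ∷ rs

letters : List ℕ → List ℕ
letters []      = []
letters (x ∷ p) = place x (letters p)

place-all : ∀ {P : ℕ → Set} {x} rs → P x → All P rs → All P (place x rs)
place-all []       px []       = px ∷ []
place-all {x = x} (r ∷ rs) px (pr ∷ prs) with r <? x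
... | yes _ = pr ∷ place-all rs px prs
... | no  _ = px ∷ prs

place-ascending : ∀ x {rs} → Ascending rs → All (x ≢_) rs → Ascending (place x rs)
place-ascending x []       _        = [] ∷ []
place-ascending x (_∷_ {r} {rs} a as) (n ∷ ns) with r <? x
... | yes r<x = place-all rs r<x a ∷ place-ascending x as ns
... | no  r≮x = All.map (≤-<-trans (≮⇒≥ r≮x)) a ∷ as

letters-⊆ : ∀ p → All (_∈ p) (letters p)
letters-⊆ []      = []
letters-⊆ (x ∷ p) = place-all (letters p) (here refl) (All.map there (letters-⊆ p))

letters-ascending : ∀ p → Unique p → Ascending (letters p)
letters-ascending []      _       = []
letters-ascending (x ∷ p) (n ∷ u) =
  place-ascending x (letters-ascending p u) (All.map (All.lookup n) (letters-⊆ p))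

gate-mono : ∀ {P Q : Set} (d : Dec P) (e : Dec Q) → (P → Q) → gate d 1 ≤ gate e 1
gate-mono (yes p) (yes q) f = ≤-refl
gate-mono (yes p) (no ¬q) f = contradiction (f p) ¬q
gate-mono (no _)  e       f = z≤n

rank-mono : ∀ {x y} p → x ≤ y → rank x p ≤ rank y p
rank-mono []      x≤y = z≤n
rank-mono {x} {y} (z ∷ p) x≤y =
  +-mono-≤ (gate-mono (z <? x) (z <? y) (λ z<x → <-≤-trans z<x x≤y)) (rank-mono p x≤y)

rank-< : ∀ {x y p} → x ∈ p → x < y → rank x p < rank y p
rank-< {x} {y} {_ ∷ p} (here refl) x<y =
  subst₂ _<_ (sym (rank-∷-≥ {x} {x} p ≤-refl)) (sym (rank-∷-< p x<y)) (s≤s (rank-mono p (<⇒≤ x<y)))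
rank-< {x} {y} {z ∷ p} (there m) x<y =
  +-mono-≤-< (gate-mono (z <? x) (z <? y) (λ z<x → <-trans z<x x<y)) (rank-< m x<y)

row-code : ∀ p → Unique p → row (code p) ≡ map (λ y → rank y p) (letters p)
row-code []      u       = refl
row-code (x ∷ p) (n ∷ u) = trans (cong (bump (rank x p)) (row-code p u))
  (go (letters p) (letters-⊆ p) (letters-ascending p u))
  where
  shifted : ∀ rs → All (x <_) rs → map suc (map (λ y → rank y p) rs) ≡ map (λ y → rank y (x ∷ p)) rs
  shifted []       []       = refl
  shifted (r ∷ rs) (l ∷ ls) = cong₂ _∷_ (sym (rank-∷-< p l)) (shifted rs ls)
  go : ∀ rs → All (_∈ p) rs → Ascending rs →
       bump (rank x p) (map (λ y → rank y p) rs) ≡ map (λ y → rank y (x ∷ p)) (place x rs)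
  go []       _        _        = cong [_] (sym (rank-∷-≥ {x} {x} p ≤-refl))
  go (r ∷ rs) (m ∷ ms) (a ∷ as) with r <? x
  ... | yes r<x = trans (bump-< _ (rank-< m r<x))
                        (cong₂ _∷_ (sym (rank-∷-≥ p (<⇒≤ r<x))) (go rs ms as))
  ... | no  r≮x = trans (bump-≥ _ (rank-mono p (≮⇒≥ r≮x)))
      (cong₂ _∷_ (sym (rank-∷-≥ {x} {x} p ≤-refl)) (shifted rs (All.map (≤-<-trans (≮⇒≥ r≮x)) a)))

width-code : ∀ p → Unique p → width (code p) ≡ length (letters p)
width-code p u = trans (cong length (row-code p u)) (length-map _ (letters p))

-- g assigns to each opener its closer; a chain lists the openers of a nesting from the inside
-- to the outside.
module Chains (g : ℕ → ℕ) where

  Chain : List ℕ → Set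
  Chain = Linked (λ x y → y < x × g x < g y)

  Ordered : List ℕ → Set
  Ordered = AllPairs (λ x y → g x < g y)

  -- One half of Schensted's theorem: the k-th entry of the row is at most the last letter of any
  -- increasing subsequence of length k.
  data Reach (x : ℕ) : ℕ → List ℕ → Set where
    stop : ∀ {rs} → Reach x 0 rs
    more : ∀ {k r rs} → r ≤ x → Reach x k rs → Reach x (suc k) (r ∷ rs)

  reach-length : ∀ {x k rs} → Reach x k rs → k ≤ length rs
  reach-length stop       = z≤n
  reach-length (more _ r) = s≤s (reach-length r)

  reach-place : ∀ {x k rs} y → Reach x k rs → Reach x k (place y rs)
  reach-place y stop = stop
  reach-place y (more {r = r} r≤x rest) with r <? y
  ... | yes _  = more r≤x (reach-place y rest)
  ... | no r≮y = more (≤-trans (≮⇒≥ r≮y) r≤x) rest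

  reach-extend : ∀ {z y k rs} → z < y → Reach z k rs → Reach y (suc k) (place y rs)
  reach-extend {rs = []} z<y stop = more ≤-refl stop
  reach-extend {y = y} {rs = r ∷ rs} z<y stop with r <? y
  ... | yes r<y = more (<⇒≤ r<y) stop
  ... | no _    = more ≤-refl stop
  reach-extend {y = y} z<y (more {r = r} r≤z rest) with r <? y
  ... | yes r<y = more (<⇒≤ r<y) (reach-extend z<y rest)
  ... | no r≮y  = contradiction (≤-<-trans r≤z z<y) r≮y

  reach-new : ∀ y rs → Reach y 1 (place y rs)
  reach-new y []       = more ≤-refl stop
  reach-new y (r ∷ rs) with r <? y
  ... | yes r<y = more (<⇒≤ r<y) stop
  ... | no _    = more ≤-refl stop

  chain-above : ∀ {x c} → Chain (x ∷ c) → All (λ y → y < x × g x < g y) c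
  chain-above [-] = []
  chain-above ((y<x , gx<gy) ∷ ch) = (y<x , gx<gy) ∷
    All.map (λ { (z<y , gy<gz) → <-trans z<y y<x , <-trans gx<gy gy<gz }) (chain-above ch)

  -- If `x` is the newest letter, it is placed beyond the entries reached by the rest of the chain,
  -- or replaces one further right. If the newest letter is another one, its closer is too early for
  -- it to belong to the chain, and its insertion only lowers entries.
  chain-reach : ∀ p x c → Ordered p → Chain (x ∷ c) → All (_∈ p) (x ∷ c) → Reach x (suc (length c)) (letters p)
  chain-reach (z ∷ p) x c (o ∷ os) ch (here refl ∷ ms) = head c ch ms
    where
    inside : ∀ {y} → g x < g y → y ∈ z ∷ p → y ∈ p
    inside gx<gy (here refl) = contradiction gx<gy (<-irrefl refl)
    inside _     (there m)   = m
    head : ∀ c → Chain (x ∷ c) → All (_∈ z ∷ p) c → Reach x (suc (length c)) (place x (letters p))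
    head []      ch ms = reach-new x (letters p)
    head (y ∷ c) ch ms = reach-extend (proj₁ (All.head (chain-above ch)))
      (chain-reach p y c os (Linked.tail ch)
        (All.zipWith (λ { ((_ , lt) , m) → inside lt m }) (chain-above ch , ms)))
  chain-reach (z ∷ p) x c (o ∷ os) ch (there m ∷ ms) =
    reach-place z (chain-reach p x c os ch (m ∷ All.zipWith (λ { ((_ , lt) , m′) → inside lt m′ }) (chain-above ch , ms)))
    where
    inside : ∀ {y} → g x < g y → y ∈ z ∷ p → y ∈ p
    inside gx<gy (here refl) = contradiction (<-trans (All.lookup o m) gx<gy) (<-irrefl refl)
    inside _     (there m)   = m

  chain-width : ∀ p c → Unique p → Ordered p → Chain c → All (_∈ p) c → length c ≤ width (code p)
  chain-width p []      u o ch ms = z≤n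
  chain-width p (x ∷ c) u o ch ms = subst (suc (length c) ≤_) (sym (width-code p u))
    (reach-length (chain-reach p x c o ch ms))

  -- The other half of Schensted's theorem: the entry at position k, counted from 0, ends an
  -- increasing subsequence of length k + 1.
  data Ends (p : List ℕ) : ℕ → List ℕ → Set where
    []  : ∀ {k} → Ends p k []
    _∷_ : ∀ {k r rs} → (∃ λ c → Chain (r ∷ c) × All (_∈ p) (r ∷ c) × length c ≡ k) →
          Ends p (suc k) rs → Ends p k (r ∷ rs)

  ends-there : ∀ {p k rs} x → Ends p k rs → Ends (x ∷ p) k rs
  ends-there x []                      = []
  ends-there x ((c , ch , ms , e) ∷ es) = (c , ch , All.map there ms , e) ∷ ends-there x es

  -- The new letter extends a subsequence that ends at its left neighbour in the row.
  ends-place : ∀ {p k x rs} → All (λ y → g x < g y) p →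
    (∃ λ c → Chain (x ∷ c) × All (_∈ x ∷ p) (x ∷ c) × length c ≡ k) →
    Ends p k rs → Ends (x ∷ p) k (place x rs)
  ends-place o e [] = e ∷ []
  ends-place {x = x} o e (_∷_ {r = r} (c , ch , m ∷ ms , len) es) with r <? x
  ... | no _    = e ∷ ends-there x es
  ... | yes r<x = (c , ch , All.map there (m ∷ ms) , len) ∷
    ends-place o (r ∷ c , (r<x , All.lookup o m) ∷ ch , here refl ∷ All.map there (m ∷ ms) , cong suc len) es

  ends-letters : ∀ p → Ordered p → Ends p 0 (letters p)
  ends-letters []      _        = []
  ends-letters (x ∷ p) (o ∷ os) = ends-place o ([] , [-] , here refl ∷ [] , refl) (ends-letters p os)

  ends-chain : ∀ {p k rs} M → Ends p k rs → M < length rs →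
               ∃ λ c → Chain c × All (_∈ p) c × length c ≡ suc (M + k)
  ends-chain zero    ((c , ch , ms , refl) ∷ _) _  = _ ∷ c , ch , ms , refl
  ends-chain {k = k} (suc M) (_ ∷ es) (s≤s lt) with ends-chain M es lt
  ... | c , ch , ms , e = c , ch , ms , trans e (cong suc (+-suc M k))

  wide-chain : ∀ M p → Unique p → Ordered p → M < width (code p) →
               ∃ λ c → Chain c × All (_∈ p) c × length c ≡ suc M
  wide-chain M p u o w with ends-chain M (ends-letters p o) (subst (M <_) (width-code p u) w)
  ... | c , ch , ms , e = c , ch , ms , trans e (cong suc (+-identityʳ M))

-- g is the closer function used to measure nestings.  It may differ from f only at points whose
-- arc is still open at the end, where it takes values ≥ n.
module Sweep (f g : ℕ → ℕ) (n : ℕ) (agree : ∀ i → i < n → g i < n → g i ≡ f i) where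

  open Chains g

  -- For openers below `t`, `late` and `complete` make `p` the list of those whose arcs cross time
  -- `t`.
  record Pending (t : ℕ) (p : List ℕ) : Set where
    constructor pending
    field
      bound    : t ≤ n
      late     : ∀ {i} → i ∈ p → t ≤ g i
      complete : ∀ {i} → i < t → t ≤ g i → i ∈ p
      ordered  : Ordered p

  open Pending

  early : ∀ {t p} → Pending t p → ∀ {i} → i < t → i ∉ p → g i ≡ f i
  early P {i} i<t i∉p = agree i (<-≤-trans i<t (bound P))
    (<-≤-trans (≰⇒> (i∉p ∘ complete P i<t)) (bound P))

  pending-opn : ∀ {t p q w} → Insert t p q → Enc f t p w → Pending (suc t) q → Pending t p
  pending-opn {t} {p} {q} ins e P = record
    { bound    = <⇒≤ (bound P)
    ; late     = <⇒≤ ∘ late P ∘ insert-old ins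
    ; complete = comp
    ; ordered  = insert-pairs ins (ordered P) }
    where
    comp : ∀ {i} → i < t → t ≤ g i → i ∈ p
    comp {i} i<t t≤gi with i ∈? q
    ... | yes m with insert-cases ins m
    ...   | inj₁ refl = contradiction i<t (<-irrefl refl)
    ...   | inj₂ m′   = m′
    comp {i} i<t t≤gi | no i∉q = contradiction (subst (t ≤_) (early P (m<n⇒m<1+n i<t) i∉q) t≤gi)
      (<⇒≱ (proj₁ (enc-matched e i i<t (i∉q ∘ insert-old ins))))

  pending-fix : ∀ {t p w} → f t ≡ t → Enc f t p w → Pending (suc t) p → Pending t p
  pending-fix {t} {p} ft e P = record
    { bound    = <⇒≤ (bound P)
    ; late     = <⇒≤ ∘ late P
    ; complete = comp
    ; ordered  = ordered P }
    where
    comp : ∀ {i} → i < t → t ≤ g i → i ∈ p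
    comp {i} i<t t≤gi with i ∈? p
    ... | yes m = m
    ... | no i∉p = contradiction (subst (t ≤_) (early P (m<n⇒m<1+n i<t) i∉p) t≤gi)
      (<⇒≱ (proj₁ (enc-matched e i i<t i∉p)))

  pending-cls : ∀ {t j p w} → f t ≡ j → f j ≡ t → Enc f t (j ∷ p) w → Pending (suc t) p → Pending t (j ∷ p)
  pending-cls {t} {j} {p} ft fj e P with enc-unique e
  ... | n ∷ _ = record
    { bound    = <⇒≤ (bound P)
    ; late     = λ { (here refl) → ≤-reflexive (sym gj) ; (there m) → <⇒≤ (late P m) }
    ; complete = comp
    ; ordered  = All.tabulate (λ m → subst (_< _) (sym gj) (late P m)) ∷ ordered P }
    where
    gj : g j ≡ t
    gj = trans (early P (m<n⇒m<1+n (All.head (enc-< e))) (λ m → All.lookup n m refl)) fj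
    comp : ∀ {i} → i < t → t ≤ g i → i ∈ j ∷ p
    comp {i} i<t t≤gi with i ∈? j ∷ p
    ... | yes m = m
    ... | no i∉ = contradiction (subst (t ≤_) (early P (m<n⇒m<1+n i<t) (i∉ ∘ there)) t≤gi)
      (<⇒≱ (proj₁ (enc-matched e i i<t i∉)))

  -- The two ways to violate the width conditions of `Good`: too many nested arcs, or too many of
  -- them around a fixed point.
  data Obstruction (M : ℕ) : Set where
    arcs : ∀ c → Chain c → length c ≡ suc M → All (λ x → x < n × x < g x) c → Obstruction M
    loop : ∀ i c → i < n → g i ≡ i → Chain c → length c ≡ M → All (λ x → x < i × i < g x) c → Obstruction M

  private
    wide-arcs : ∀ M {t p w} → Enc f t p w → Pending t p → M < width (code p) → Obstruction M
    wide-arcs M {t} {p} e P w with wide-chain M p (enc-unique e) (ordered P) w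
    ... | c , ch , ms , len = arcs c ch len (All.map
      (λ m → let x<t = All.lookup (enc-< e) m in <-≤-trans x<t (bound P) , <-≤-trans x<t (late P m)) ms)

    wide-loop : ∀ M {t p w} → f t ≡ t → Enc f t p w → Pending (suc t) p → M ≤ width (code p) → Obstruction M
    wide-loop M {t} {p} ft e P w = build M w
      where
      gt : g t ≡ t
      gt = trans (early P (n<1+n t) (top∉ (enc-< e))) ft
      build : ∀ M → M ≤ width (code p) → Obstruction M
      -- `wide-chain` only produces nonempty chains, so a lone loop is a separate case.
      build zero    _ = loop t [] (bound P) gt [] refl []
      build (suc M) w with wide-chain M p (enc-unique e) (ordered P) w
      ... | c , ch , ms , len = loop t c (bound P) gt ch len
        (All.map (λ m → All.lookup (enc-< e) m , late P m) ms)

  -- A width condition failing at some time yields, by `wide-chain`, nested arcs which all cross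
  -- that time.
  good-or-obstruction : ∀ M {t p w} → Enc f t p w → Pending t p →
                        Good M t (fixes w) (code p) w ⊎ Obstruction M
  good-or-obstruction M done P = inj₁ done
  good-or-obstruction M e₀@(opn {q = q} ins e) P with M <? width (code q)
  ... | yes w = inj₂ (wide-arcs M e₀ P w)
  ... | no ¬w with good-or-obstruction M e (pending-opn ins e P)
  ...   | inj₂ o = inj₂ o
  ...   | inj₁ good = inj₁ (build q ins (≮⇒≥ ¬w) (subst (λ σ → Good M _ _ σ _) (sym (delmax-code ins (enc-< e))) good))
    where
    build : ∀ {t m p w} q → Insert t p q → width (code q) ≤ M → Good M t m (delmax (code q)) w →
            Good M (suc t) m (code q) (opn ∷ w)
    build (x ∷ q) _ w≤ good = opn w≤ good
  good-or-obstruction M (fix {p = p} ft e) P with width (code p) <? M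
  ... | no ¬w = inj₂ (wide-loop M ft e P (≮⇒≥ ¬w))
  ... | yes w with good-or-obstruction M e (pending-fix ft e P)
  ...   | inj₂ o    = inj₂ o
  ...   | inj₁ good = inj₁ (fix w good)
  good-or-obstruction M e₀@(cls {j = j} {p} ft fj refl e) P with M <? width (code p)
  ... | yes w = inj₂ (wide-arcs M e₀ P w)
  ... | no ¬w with good-or-obstruction M e (pending-cls ft fj e P)
  ...   | inj₂ o    = inj₂ o
  ...   | inj₁ good = inj₁ (cls (≮⇒≥ ¬w) (subst (rank j p ≤_) (sym (length-code p)) (rank≤length j p)) good)

  good-width : ∀ {M t m σ w} → Good M t m σ w → width σ ≤ M
  good-width done        = z≤n
  good-width (opn w _)   = w
  good-width (cls w _ _) = w
  good-width (fix w _)   = <⇒≤ w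

  private
    crossing-width : ∀ {t p w} → Enc f t p w → Pending t p → ∀ c → Chain c →
                     All (λ x → x < t × t ≤ g x) c → length c ≤ width (code p)
    crossing-width {p = p} e P c ch bs = chain-width p c (enc-unique e) (ordered P) ch
      (All.map (λ { (x<t , t≤gx) → complete P x<t t≤gx }) bs)

    previous : ∀ {M t m σ p w} → Good M (suc t) m σ w → Enc f (suc t) p w → Pending (suc t) p → σ ≡ code p →
               ∃ λ m′ → ∃ λ p′ → ∃ λ w′ → Good M t m′ (code p′) w′ × Enc f t p′ w′ × Pending t p′
    previous (opn _ good) (opn ins e) P eq = _ , _ , _ ,
      subst (λ τ → Good _ _ _ τ _) (trans (cong delmax eq) (delmax-code ins (enc-< e))) good , e , pending-opn ins e P
    previous (fix _ good) (fix ft e) P refl = _ , _ , _ , good , e , pending-fix ft e P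
    previous (cls _ _ good) (cls ft fj refl e) P refl = _ , _ , _ , good , e , pending-cls ft fj e P

    fix-width : ∀ {M t m σ p w} → Good M (suc t) m σ w → Enc f (suc t) p w → Pending (suc t) p →
                g t ≡ t → width σ < M
    fix-width {t = t} _ (opn ins e) P gt = contradiction (late P (insert-new ins)) (<⇒≱ (s≤s (≤-reflexive gt)))
    fix-width (fix w _) (fix _ _) P gt = w
    fix-width {t = t} _ (cls ft _ _ e) P gt = contradiction
      (trans (sym ft) (trans (sym (early P (n<1+n t) (top∉ (All.tail (enc-< e))))) gt))
      (<⇒≢ (All.head (enc-< e)))

  -- All arcs of the chain cross time `suc x`, where `x` is the innermost opener. The recursion
  -- descends to that time and uses the width bound there.
  arcs-bound : ∀ {M t m p w} → Good M t m (code p) w → Enc f t p w → Pending t p →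
    ∀ x c → Chain (x ∷ c) → x < t → x < g x → suc (length c) ≤ M
  arcs-bound {M} {suc t} good e P x c ch x≤t x<gx with m≤n⇒m<n∨m≡n (s≤s⁻¹ x≤t)
  ... | inj₂ refl = ≤-trans
    (crossing-width e P (x ∷ c) ch ((n<1+n x , x<gx) ∷
       All.map (λ { (y<x , gx<gy) → m<n⇒m<1+n y<x , <-trans x<gx gx<gy }) (chain-above ch)))
    (good-width good)
  ... | inj₁ x<t with previous good e P refl
  ...   | _ , _ , _ , good′ , e′ , P′ = arcs-bound good′ e′ P′ x c ch x<t x<gx

  -- The same at time `suc i`, where the step is a fixed point and demands the strict bound.
  loop-bound : ∀ {M t m p w} → Good M t m (code p) w → Enc f t p w → Pending t p →
    ∀ i c → i < t → g i ≡ i → Chain c → All (λ x → x < i × i < g x) c → length c < M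
  loop-bound {M} {suc t} good e P i c i≤t gi ch bs with m≤n⇒m<n∨m≡n (s≤s⁻¹ i≤t)
  ... | inj₂ refl = ≤-<-trans
    (crossing-width e P c ch (All.map (λ { (x<i , i<gx) → m<n⇒m<1+n x<i , i<gx }) bs))
    (fix-width good e P gi)
  ... | inj₁ i<t with previous good e P refl
  ...   | _ , _ , _ , good′ , e′ , P′ = loop-bound good′ e′ P′ i c i<t gi ch bs

-- Involutions as vectors

fun : ∀ {n} → Perm n → ℕ → ℕ
fun {n} α i with i <? n
... | yes i<n = toℕ (lookup α (fromℕ< i<n))
... | no  _   = i

fun-toℕ : ∀ {n} (α : Perm n) i → fun α (toℕ i) ≡ toℕ (lookup α i)
fun-toℕ {n} α i with toℕ i <? n
... | yes i<n = cong (toℕ ∘ lookup α) (FinP.fromℕ<-toℕ i i<n)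
... | no  i≮n = contradiction (FinP.toℕ<n i) i≮n

below : ∀ {n} {P : ℕ → Set} → (∀ (i : Fin n) → P (toℕ i)) → ∀ i → i < n → P i
below {P = P} h i i<n = subst P (FinP.toℕ-fromℕ< i<n) (h (fromℕ< i<n))

fun-< : ∀ {n} (α : Perm n) i → i < n → fun α i < n
fun-< {n} α = below λ i → subst (_< n) (sym (fun-toℕ α i)) (FinP.toℕ<n (lookup α i))

fun-involutive : ∀ {n} {α : Perm n} → IsInvolution α → ∀ i → i < n → fun α (fun α i) ≡ i
fun-involutive {n} {α} inv = below λ i →
  trans (cong (fun α) (fun-toℕ α i)) (trans (fun-toℕ α (lookup α i)) (cong toℕ (inv i)))

fun-injective : ∀ {n} {α β : Perm n} → (∀ i → i < n → fun α i ≡ fun β i) → α ≡ β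
fun-injective {n} {α} {β} eq = trans (sym (VecP.tabulate∘lookup α)) (trans
  (VecP.tabulate-cong λ i → FinP.toℕ-injective
    (trans (sym (fun-toℕ α i)) (trans (eq (toℕ i) (FinP.toℕ<n i)) (fun-toℕ β i))))
  (VecP.tabulate∘lookup β))

module FromFunction {n} (f : ℕ → ℕ) (f< : ∀ i → i < n → f i < n) where

  perm : Perm n
  perm = Vec.tabulate λ i → fromℕ< (f< (toℕ i) (FinP.toℕ<n i))

  fun-perm : ∀ i → i < n → fun perm i ≡ f i
  fun-perm = below λ i → trans (fun-toℕ perm i)
    (trans (cong toℕ (VecP.lookup∘tabulate _ i)) (FinP.toℕ-fromℕ< _))

  perm-involution : (∀ i → i < n → f (f i) ≡ i) → IsInvolution perm
  perm-involution ff i = FinP.toℕ-injective (begin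
    toℕ (lookup perm (lookup perm i))  ≡⟨ sym (fun-toℕ perm (lookup perm i)) ⟩
    fun perm (toℕ (lookup perm i))     ≡⟨ cong (fun perm) (sym (fun-toℕ perm i)) ⟩
    fun perm (fun perm (toℕ i))        ≡⟨ cong (fun perm) (fun-perm _ i<n) ⟩
    fun perm (f (toℕ i))               ≡⟨ fun-perm _ (f< _ i<n) ⟩
    f (f (toℕ i))                      ≡⟨ ff _ i<n ⟩
    toℕ i                              ∎)
    where
    open ≡-Reasoning
    i<n : toℕ i < n
    i<n = FinP.toℕ<n i

-- The increasing list of fixed points and its code

fixedList : ∀ {n} → Perm n → List ℕ
fixedList {n} α = map toℕ (filter (λ i → lookup α i FinP.≟ i) (Vec.toList (allFin n)))

fixedList-ascending : ∀ {n} (α : Perm n) → Ascending (fixedList α)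
fixedList-ascending {n} α = AllPairsP.map⁺ (AllPairsP.filter⁺ (λ i → lookup α i FinP.≟ i) (positions id id))
  where
  all : ∀ {k} {P : Fin n → Set} (f : Fin k → Fin n) → (∀ i → P (f i)) → All P (Vec.toList (Vec.tabulate f))
  all {zero}  f h = []
  all {suc k} f h = h Fin.zero ∷ all (f ∘ Fin.suc) (h ∘ Fin.suc)
  positions : ∀ {k} (f : Fin k → Fin n) → (∀ {i j} → toℕ i < toℕ j → toℕ (f i) < toℕ (f j)) →
              AllPairs (λ i j → toℕ i < toℕ j) (Vec.toList (Vec.tabulate f))
  positions {zero}  f mono = []
  positions {suc k} f mono = all (f ∘ Fin.suc) (λ i → mono (s≤s z≤n)) ∷ positions (f ∘ Fin.suc) (mono ∘ s≤s)

∈-fixedList⁺ : ∀ {n} (α : Perm n) i → i < n → fun α i ≡ i → i ∈ fixedList α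
∈-fixedList⁺ {n} α = below λ i e → ∈-map⁺ toℕ (∈-filter⁺ (λ i → lookup α i FinP.≟ i)
  (∈-toList⁺ (∈-allFin⁺ i)) (FinP.toℕ-injective (trans (sym (fun-toℕ α i)) e)))

∈-fixedList⁻ : ∀ {n} (α : Perm n) {i} → i ∈ fixedList α → i < n × fun α i ≡ i
∈-fixedList⁻ {n} α m with ∈-map⁻ toℕ m
... | i , m′ , refl = FinP.toℕ<n i , trans (fun-toℕ α i)
  (cong toℕ (proj₂ (∈-filter⁻ (λ i → lookup α i FinP.≟ i) {xs = Vec.toList (allFin n)} m′)))

length-fixedList : ∀ {n} (α : Perm n) → length (fixedList α) ≡ fixedPoints α
length-fixedList {n} α = length-map toℕ (filter (λ i → lookup α i FinP.≟ i) (Vec.toList (allFin n)))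

ascending-unique : ∀ {p} → Ascending p → Unique p
ascending-unique = AllPairs.map <⇒≢

fixed-card : ∀ {n} (α : Perm n) → Card (λ i → i < n × fun α i ≡ i) (fixedPoints α)
fixed-card α = fixedList α , ascending-unique (fixedList-ascending α) ,
  (λ i → mk⇔ (∈-fixedList⁻ α) (λ { (i<n , e) → ∈-fixedList⁺ α i i<n e })) , length-fixedList α

rank-least : ∀ {x} p → All (x <_) p → rank x p ≡ 0
rank-least []      []       = refl
rank-least (y ∷ p) (l ∷ ls) = trans (rank-∷-≥ p (<⇒≤ l)) (rank-least p ls)

rank-zero : ∀ {x} p → rank x p ≡ 0 → All (x ≤_) p
rank-zero     []      e = []
rank-zero {x} (y ∷ p) e with y <? x
... | no y≮x = ≮⇒≥ y≮x ∷ rank-zero p e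

-- The last letter of a word is listed first, so an ascending list is a decreasing word, and no
-- letter has a smaller one before it.
code-ascending : ∀ {p} → Ascending p → code p ≡ replicate (length p) 0
code-ascending []                  = refl
code-ascending (_∷_ {xs = p} a as) = cong₂ _∷_ (rank-least p a) (code-ascending as)

ascending-code : ∀ {p} m → Unique p → code p ≡ replicate m 0 → Ascending p
ascending-code {[]}    m       _       _ = []
ascending-code {x ∷ p} (suc m) (n ∷ u) e =
  All.zipWith (λ { (le , ne) → ≤∧≢⇒< le ne }) (rank-zero p (∷-injectiveˡ e) , n) ∷ ascending-code m u (∷-injectiveʳ e)

ascending-ext : ∀ {p q} → Ascending p → Ascending q →
                (∀ {x} → x ∈ p → x ∈ q) → (∀ {x} → x ∈ q → x ∈ p) → p ≡ q
ascending-ext []      []      f g = refl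
ascending-ext []      (_ ∷ _) f g with g (here refl)
... | ()
ascending-ext (_ ∷ _) []      f g with f (here refl)
... | ()
ascending-ext {x ∷ p} {y ∷ q} (a ∷ as) (b ∷ bs) f g with head≡
  where
  least : ∀ {x y p} → All (x <_) p → y ∈ x ∷ p → x ≤ y
  least a (here refl) = ≤-refl
  least a (there m)   = <⇒≤ (All.lookup a m)
  head≡ : x ≡ y
  head≡ = ≤-antisym (least a (g (here refl))) (least b (f (here refl)))
... | refl = cong (x ∷_) (ascending-ext as bs (strip a f) (strip b g))
  where
  strip : ∀ {p q} → All (x <_) p → (∀ {z} → z ∈ x ∷ p → z ∈ x ∷ q) → ∀ {z} → z ∈ p → z ∈ q
  strip a f m with f (there m)
  ... | here refl = contradiction (All.lookup a m) (<-irrefl refl)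
  ... | there m′  = m′

-- The closed arcs of an enhanced nesting

closed : ∀ {n} → List (Fin n × Fin n) → List (Fin n × Fin n)
closed []             = []
closed ((i , j) ∷ []) with toℕ i ≟ toℕ j
... | yes _ = []
... | no  _ = [ (i , j) ]
closed (p ∷ q ∷ ps)   = p ∷ closed (q ∷ ps)

closed-dots : ∀ {n} (ps : List (Fin n × Fin n)) →
  enhDots ps ≡ 2 * length (closed ps) ⊎ enhDots ps ≡ 1 + 2 * length (closed ps)
closed-dots []             = inj₁ refl
closed-dots ((i , j) ∷ []) with toℕ i ≟ toℕ j
... | yes _ = inj₂ refl
... | no  _ = inj₁ refl
closed-dots (_ ∷ q ∷ ps) with closed-dots (q ∷ ps)
... | inj₁ e = inj₁ (trans (cong (2 +_) e) (sym (*-suc 2 (length (closed (q ∷ ps))))))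
... | inj₂ e = inj₂ (trans (cong (2 +_) e) (cong suc (sym (*-suc 2 (length (closed (q ∷ ps)))))))

closed-nesting : ∀ {n} (α : Perm n) ps → EnhNesting α ps → All (ClosedArc α) (closed ps) × Nested (closed ps)
closed-nesting α []             _             = [] , tt
closed-nesting α ((i , j) ∷ []) (((e , le) ∷ []) , _) with toℕ i ≟ toℕ j
... | yes _  = [] , tt
... | no i≢j = (e , ≤∧≢⇒< le i≢j) ∷ [] , tt
closed-nesting α ((i , j) ∷ (i′ , j′) ∷ ps) (((e , _) ∷ as@((_ , le′) ∷ _)) , i<i′ , j′<j , nest)
  with closed-nesting α ((i′ , j′) ∷ ps) (as , nest)
... | as′ , nest′ = (e , <-trans i<i′ (≤-<-trans le′ j′<j)) ∷ as′ , extend ps nest′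
  where
  extend : ∀ ps → Nested (closed ((i′ , j′) ∷ ps)) → Nested ((i , j) ∷ closed ((i′ , j′) ∷ ps))
  extend []       nest with toℕ i′ ≟ toℕ j′
  ... | yes _ = tt
  ... | no  _ = i<i′ , j′<j , tt
  extend (q ∷ ps) nest = i<i′ , j′<j , nest

closed⇒enh : ∀ {n} (α : Perm n) {ps} → All (ClosedArc α) ps → Nested ps → EnhNesting α ps
closed⇒enh α as nest = All.map (λ { (e , lt) → e , <⇒≤ lt }) as , nest

closed-enhDots : ∀ {n} (α : Perm n) ps → All (ClosedArc α) ps → enhDots ps ≡ 2 * length ps
closed-enhDots α []             _              = refl
closed-enhDots α ((i , j) ∷ []) ((_ , lt) ∷ _) with toℕ i ≟ toℕ j
... | yes e = contradiction e (<⇒≢ lt)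
... | no  _ = refl
closed-enhDots α (_ ∷ q ∷ ps) (_ ∷ as) =
  trans (cong (2 +_) (closed-enhDots α (q ∷ ps) as)) (sym (*-suc 2 (suc (length ps))))

enhDots-positive : ∀ {n} (p : Fin n × Fin n) ps → 0 < enhDots (p ∷ ps)
enhDots-positive (i , j) [] with toℕ i ≟ toℕ j
... | yes _ = s≤s z≤n
... | no  _ = s≤s z≤n
enhDots-positive p (q ∷ ps) = s≤s z≤n

-- Enhanced nestings and sweeps from the empty word

EnhAtMost FutAtMost : ∀ {n} → ℕ → Perm n → Set
EnhAtMost d α = ∀ ps → EnhNesting α ps → enhDots ps ≤ d
FutAtMost d α = ∀ x → FutNesting α x → futDots x ≤ d

cons-chain : ∀ {g y} c → Chains.Chain g c → All (λ x → x < y × g y < g x) c → Chains.Chain g (y ∷ c)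
cons-chain []      ch _       = [-]
cons-chain (x ∷ c) ch (b ∷ _) = b ∷ ch

module Enhanced {n} (α : Perm n) (inv : IsInvolution α) where

  g : ℕ → ℕ
  g = fun α

  open Chains g
  open Sweep g g n (λ _ _ _ → refl)

  matched : MatchedBelow g n []
  matched i i<n _ = fun-< α i i<n , (λ ()) , fun-involutive inv i i<n

  initial : Pending n []
  initial = record
    { bound = ≤-refl ; late = λ () ; ordered = []
    ; complete = λ {i} i<n n≤gi → contradiction n≤gi (<⇒≱ (fun-< α i i<n)) }

  fixes≡ : ∀ {w} → Enc g n [] w → fixes w ≡ fixedPoints α
  fixes≡ e = card-unique (fixes-card e)
    (card-cong (λ { i (i<n , e) → i<n , (λ ()) , e }) (λ { i (i<n , _ , e) → i<n , e }) (fixed-card α))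

  arc : ∀ {i j : Fin n} → lookup α i ≡ j → g (toℕ i) ≡ toℕ j
  arc {i} e = trans (fun-toℕ α i) (cong toℕ e)

  -- `go` walks inwards and collects the openers passed in the chain `c`. The innermost pair decides
  -- between `arcs-bound` and `loop-bound`; the latter leaves room for a whole further arc, hence
  -- for the single dot of the loop.
  good⇒bound : ∀ {M m w} → Good M n m [] w → Enc g n [] w → EnhAtMost (2 * M) α
  good⇒bound         good e []             nesting   = z≤n
  good⇒bound {M = M} good e ((i , j) ∷ ps) (as , nest) = go i j [] ps as nest [] []
    where
    go : ∀ i j c ps → All (ArcOrLoop α) ((i , j) ∷ ps) → Nested ((i , j) ∷ ps) → Chain c →
         All (λ x → x < toℕ i × toℕ j < g x) c → 2 * length c + enhDots ((i , j) ∷ ps) ≤ 2 * M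
    go i j c [] ((ij , le) ∷ _) _ ch bs with toℕ i ≟ toℕ j
    ... | yes i≡j = begin
      2 * length c + 1     ≡⟨ +-comm (2 * length c) 1 ⟩
      1 + 2 * length c     ≤⟨ n≤1+n _ ⟩
      2 + 2 * length c     ≡⟨ *-suc 2 (length c) ⟨
      2 * suc (length c)   ≤⟨ *-monoʳ-≤ 2 (loop-bound good e initial (toℕ i) c (FinP.toℕ<n i)
                               (trans (arc ij) (sym i≡j)) ch
                               (All.map (λ { (l , r) → l , subst (_< _) (sym i≡j) r }) bs)) ⟩
      2 * M                ∎
      where open ≤-Reasoning
    ... | no i≢j = begin
      2 * length c + 2     ≡⟨ +-comm (2 * length c) 2 ⟩
      2 + 2 * length c     ≡⟨ *-suc 2 (length c) ⟨
      2 * suc (length c)   ≤⟨ *-monoʳ-≤ 2 (arcs-bound good e initial (toℕ i) c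
                               (cons-chain c ch (All.map (λ { (l , r) → l , subst (_< _) (sym (arc ij)) r }) bs))
                               (FinP.toℕ<n i) (subst (toℕ i <_) (sym (arc ij)) (≤∧≢⇒< le i≢j))) ⟩
      2 * M                ∎
      where open ≤-Reasoning
    go i j c ((i′ , j′) ∷ ps) ((ij , le) ∷ as) (i<i′ , j′<j , nest) ch bs = begin
      2 * length c + (2 + d)     ≡⟨ +-assoc (2 * length c) 2 d ⟨
      (2 * length c + 2) + d     ≡⟨ cong (_+ d) (+-comm (2 * length c) 2) ⟩
      (2 + 2 * length c) + d     ≡⟨ cong (_+ d) (*-suc 2 (length c)) ⟨
      2 * suc (length c) + d     ≤⟨ go i′ j′ (toℕ i ∷ c) ps as nest
          (cons-chain c ch (All.map (λ { (l , r) → l , subst (_< _) (sym (arc ij)) r }) bs))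
          ((i<i′ , subst (toℕ j′ <_) (sym (arc ij)) j′<j) ∷
           All.map (λ { (l , r) → <-trans l i<i′ , <-trans j′<j r }) bs) ⟩
      2 * M                      ∎
      where
      open ≤-Reasoning
      d = enhDots ((i′ , j′) ∷ ps)

  -- Rebuilds the arcs of a chain one by one, from the inside to the outside, around the nesting
  -- constructed so far.
  unwind : ∀ c i j ps → Chain c → All (λ x → x < toℕ i × toℕ j < g x) c → toℕ i ≤ toℕ j →
    EnhNesting α ((i , j) ∷ ps) →
    ∃ λ qs → EnhNesting α qs × enhDots qs ≡ 2 * length c + enhDots ((i , j) ∷ ps)
  unwind []      i j ps ch bs le nesting = (i , j) ∷ ps , nesting , refl
  unwind (x ∷ c) i j ps ch ((x<i , j<gx) ∷ _) le (as , nest)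
    with unwind c x′ y′ ((i , j) ∷ ps) (Linked.tail ch)
           (All.map (λ { (l , r) → subst (_ <_) (sym x≡) l , subst (_< _) (sym y≡) r }) (chain-above ch))
           le′
           ((FinP.toℕ-injective (trans (sym (fun-toℕ α x′)) (trans (cong g x≡) (sym y≡))) , le′) ∷ as ,
            subst (_< toℕ i) (sym x≡) x<i , subst (toℕ j <_) (sym y≡) j<gx , nest)
    where
    x<n : x < n
    x<n = <-trans x<i (FinP.toℕ<n i)
    x′ y′ : Fin n
    x′ = fromℕ< x<n
    y′ = fromℕ< (fun-< α x x<n)
    x≡ : toℕ x′ ≡ x
    x≡ = FinP.toℕ-fromℕ< x<n
    y≡ : toℕ y′ ≡ g x
    y≡ = FinP.toℕ-fromℕ< _
    le′ : toℕ x′ ≤ toℕ y′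
    le′ = subst₂ _≤_ (sym x≡) (sym y≡) (<⇒≤ (<-trans x<i (≤-<-trans le j<gx)))
  ... | qs , nesting , e = qs , nesting , trans e (trans (sym (+-assoc (2 * length c) 2 _))
        (cong (_+ enhDots ((i , j) ∷ ps)) (trans (+-comm (2 * length c) 2) (sym (*-suc 2 (length c))))))

  obstruction⇒nesting : ∀ {M} → Obstruction M → ∃ λ ps → EnhNesting α ps × 2 * M < enhDots ps
  obstruction⇒nesting (arcs (x ∷ c) ch refl ((x<n , x<gx) ∷ _))
    with unwind c x′ y′ [] (Linked.tail ch)
           (All.map (λ { (l , r) → subst (_ <_) (sym x≡) l , subst (_< _) (sym y≡) r }) (chain-above ch))
           (<⇒≤ lt)
           ((FinP.toℕ-injective (trans (sym (fun-toℕ α x′)) (trans (cong g x≡) (sym y≡))) , <⇒≤ lt) ∷ [] , tt)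
    where
    x′ y′ : Fin n
    x′ = fromℕ< x<n
    y′ = fromℕ< (fun-< α x x<n)
    x≡ : toℕ x′ ≡ x
    x≡ = FinP.toℕ-fromℕ< x<n
    y≡ : toℕ y′ ≡ g x
    y≡ = FinP.toℕ-fromℕ< _
    lt : toℕ x′ < toℕ y′
    lt = subst₂ _<_ (sym x≡) (sym y≡) x<gx
  ... | qs , nesting , e = qs , nesting , subst (2 * length c <_) (sym e)
          (m<m+n (2 * length c) (enhDots-positive _ []))
  obstruction⇒nesting (loop i c i<n gi ch refl bs)
    with unwind c i′ i′ [] ch
           (All.map (λ { (l , r) → subst (_ <_) (sym i≡) l , subst (_< _) (sym i≡) r }) bs) ≤-refl
           ((FinP.toℕ-injective (trans (sym (fun-toℕ α i′)) (trans (cong g i≡) (trans gi (sym i≡)))) , ≤-refl) ∷ [] , tt)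
    where
    i′ : Fin n
    i′ = fromℕ< i<n
    i≡ : toℕ i′ ≡ i
    i≡ = FinP.toℕ-fromℕ< i<n
  ... | qs , nesting , e = qs , nesting , subst (2 * length c <_) (sym e) (m<m+n (2 * length c) (enhDots-positive _ []))

  encoded : ∃ (Enc g n [])
  encoded = encode g n [] [] [] matched

  bound-or-nesting : ∀ M → EnhAtMost (2 * M) α ⊎ ∃ λ ps → EnhNesting α ps × 2 * M < enhDots ps
  bound-or-nesting M with encoded
  ... | w , e with good-or-obstruction M e initial
  ...   | inj₁ good = inj₁ (good⇒bound good e)
  ...   | inj₂ o    = inj₂ (obstruction⇒nesting o)

  bound⇒good : ∀ M → EnhAtMost (2 * M) α → ∃ λ w → Good M n (fixedPoints α) [] w × Enc g n [] w
  bound⇒good M bound with encoded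
  ... | w , e with good-or-obstruction M e initial
  ...   | inj₁ good = w , subst (λ k → Good M n k [] w) (fixes≡ e) good , e
  ...   | inj₂ o with obstruction⇒nesting o
  ...     | ps , nesting , lt = contradiction (bound ps nesting) (<⇒≱ lt)

EnhClass FutClass : ∀ n → ℕ → ℕ → Perm n → Set
EnhClass n M m α = IsInvolution α × fixedPoints α ≡ m × EnhAtMost (2 * M) α
FutClass n M m α = IsInvolution α × fixedPoints α ≡ m × FutAtMost (2 * M) α

enh-card : ∀ n M m → Card (EnhClass n M m) (count M n m [])
enh-card n M m = card-transport {R = λ α w → Enc (fun α) n [] w} total
  (λ { α (inv , refl , bound) → Enhanced.bound⇒good α inv M bound })
  (λ _ → enc-functional)
  (λ _ _ e e′ → fun-injective λ i i<n → proj₂ (enc-injective e e′ refl) i i<n λ ())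
  (good-card M n m [])
  where
  total : ∀ w → Good M n m [] w → ∃ λ α → EnhClass n M m α × Enc (fun α) n [] w
  total w good with decode good tt
  ... | f , [] , e , _ = perm , (inv , trans (sym (fixes≡ e′)) (good-fixes good) , good⇒bound good e′) , e′
    where
    open FromFunction {n} f (λ i i<n → proj₁ (enc-matched e i i<n λ ()))
    inv : IsInvolution perm
    inv = perm-involution λ i i<n → proj₂ (proj₂ (enc-matched e i i<n λ ()))
    open Enhanced perm inv
    e′ : Enc (fun perm) n [] w
    e′ = enc-cong e λ i i<n _ → sym (fun-perm i i<n)

-- Open matchings and sweeps from a decreasing word

module Future {n} (α : Perm n) (inv : IsInvolution α) where

  f : ℕ → ℕ
  f = fun α

  -- The fixed points become arcs to n + i, so that the open arcs mutually cross and end last.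
  g : ℕ → ℕ
  g i with f i ≟ i
  ... | yes _ = n + i
  ... | no  _ = f i

  g-fixed : ∀ {i} → f i ≡ i → g i ≡ n + i
  g-fixed {i} e with f i ≟ i
  ... | yes _ = refl
  ... | no ne = contradiction e ne

  g-moved : ∀ {i} → f i ≢ i → g i ≡ f i
  g-moved {i} ne with f i ≟ i
  ... | yes e = contradiction e ne
  ... | no _  = refl

  g-late : ∀ {i} → i < n → n ≤ g i → f i ≡ i
  g-late {i} i<n n≤gi with f i ≟ i
  ... | yes e = e
  ... | no _  = contradiction n≤gi (<⇒≱ (fun-< α i i<n))

  agree : ∀ i → i < n → g i < n → g i ≡ f i
  agree i i<n gi<n with f i ≟ i
  ... | yes _ = contradiction (m≤m+n n i) (<⇒≱ gi<n)
  ... | no _  = refl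

  open Chains g
  open Sweep f g n agree

  matched : MatchedBelow f n (fixedList α)
  matched i i<n i∉ = fun-< α i i<n ,
    (λ m → i∉ (∈-fixedList⁺ α i i<n
       (trans (sym (proj₂ (∈-fixedList⁻ α m))) (fun-involutive inv i i<n)))) ,
    fun-involutive inv i i<n

  initial : Pending n (fixedList α)
  initial = record
    { bound    = ≤-refl
    ; late     = λ m → subst (n ≤_) (sym (g-fixed (proj₂ (∈-fixedList⁻ α m)))) (m≤m+n n _)
    ; complete = λ {i} i<n n≤gi → ∈-fixedList⁺ α i i<n (g-late i<n n≤gi)
    ; ordered  = order (fixedList-ascending α) (All.tabulate (proj₂ ∘ ∈-fixedList⁻ α)) }
    where
    order : ∀ {p} → Ascending p → All (λ i → f i ≡ i) p → Ordered p
    order []       []       = []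
    order (a ∷ as) (e ∷ es) = All.zipWith (λ { (lt , e′) →
      subst₂ _<_ (sym (g-fixed e)) (sym (g-fixed e′)) (+-monoʳ-< n lt) }) (a , es) ∷ order as es

  arc : ∀ {i j : Fin n} → lookup α i ≡ j → toℕ i < toℕ j → g (toℕ i) ≡ toℕ j
  arc {i} e lt = trans (g-moved (λ fi → <⇒≢ lt (trans (sym fi) fi≡j))) fi≡j
    where
    fi≡j : f (toℕ i) ≡ _
    fi≡j = trans (fun-toℕ α i) (cong toℕ e)

  good⇒bound : ∀ {M m w} → Good M n m (code (fixedList α)) w → Enc f n (fixedList α) w → FutAtMost (2 * M) α
  good⇒bound {M} good e = λ
    { (nothing , [])             _                          → z≤n
    ; (nothing , (i , j) ∷ ps)   (as , nest)                → *-monoʳ-≤ 2 (go i j [] ps as nest [] [])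
    -- A lone open arc is already a chain of length 1, so M is positive.
    ; (just a  , [])             (fa , _)                   →
        ≤-trans (n≤1+n 1) (*-monoʳ-≤ 2 (arcs-bound good e initial (toℕ a) [] [-] (FinP.toℕ<n a) (late-open fa)))
    ; (just a  , (i , j) ∷ ps)   (fa , as , nest , a<i)     → ≤-trans
        (≤-trans (n≤1+n _) (≤-reflexive (sym (*-suc 2 (suc (length ps))))))
        (*-monoʳ-≤ 2 (go i j (toℕ a ∷ []) ps as nest [-]
          ((a<i , subst (toℕ j <_) (sym (open-end fa)) (<-≤-trans (FinP.toℕ<n j) (m≤m+n n (toℕ a)))) ∷ []))) }
    where
    open-end : ∀ {a} → lookup α a ≡ a → g (toℕ a) ≡ n + toℕ a
    open-end {a} fa = g-fixed (trans (fun-toℕ α a) (cong toℕ fa))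
    late-open : ∀ {a} → lookup α a ≡ a → toℕ a < g (toℕ a)
    late-open {a} fa = subst (toℕ a <_) (sym (open-end fa)) (<-≤-trans (FinP.toℕ<n a) (m≤m+n n (toℕ a)))
    go : ∀ i j c ps → All (ClosedArc α) ((i , j) ∷ ps) → Nested ((i , j) ∷ ps) → Chain c →
         All (λ x → x < toℕ i × toℕ j < g x) c → length c + suc (length ps) ≤ M
    go i j c [] ((ij , lt) ∷ _) _ ch bs = subst (_≤ M) (+-comm 1 (length c))
      (arcs-bound good e initial (toℕ i) c
        (cons-chain c ch (All.map (λ { (l , r) → l , subst (_< _) (sym (arc ij lt)) r }) bs))
        (FinP.toℕ<n i) (subst (toℕ i <_) (sym (arc ij lt)) lt))
    go i j c ((i′ , j′) ∷ ps) ((ij , lt) ∷ as) (i<i′ , j′<j , nest) ch bs =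
      subst (_≤ M) (sym (+-suc (length c) (suc (length ps))))
        (go i′ j′ (toℕ i ∷ c) ps as nest
          (cons-chain c ch (All.map (λ { (l , r) → l , subst (_< _) (sym (arc ij lt)) r }) bs))
          ((i<i′ , subst (toℕ j′ <_) (sym (arc ij lt)) j′<j) ∷
           All.map (λ { (l , r) → <-trans l i<i′ , <-trans j′<j r }) bs))

  Inside : List ℕ → List (Fin n × Fin n) → Set
  Inside c []             = ⊤
  Inside c ((i , j) ∷ ps) = All (λ x → x < toℕ i × toℕ j < g x) c

  -- The slack of one dot accounts for a possible open arc, which can only be the outermost one.
  unwind : ∀ c ps → Chain c → All (λ x → x < n × x < g x) c → Inside c ps →
    All (ClosedArc α) ps → Nested ps →
    ∃ λ x → FutNesting α x × 2 * (length c + length ps) ≤ suc (futDots x)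
  unwind-∷ : ∀ x c ps → Dec (f x ≡ x) → Chain (x ∷ c) → All (λ x → x < n × x < g x) (x ∷ c) →
    Inside (x ∷ c) ps → All (ClosedArc α) ps → Nested ps →
    ∃ λ z → FutNesting α z × 2 * (suc (length c) + length ps) ≤ suc (futDots z)

  unwind []      ps ch bs ins as nest = (nothing , ps) , (as , nest) , n≤1+n _
  unwind (x ∷ c) ps ch bs ins as nest = unwind-∷ x c ps (f x ≟ x) ch bs ins as nest

  unwind-∷ x c ps (yes fx) ch ((x<n , x<gx) ∷ bs) ins as nest = (just x′ , ps) ,
    (FinP.toℕ-injective (trans (sym (fun-toℕ α x′)) (trans (cong f x≡) (trans fx (sym x≡)))) ,
     as , nest , before ps ins) ,
    subst (λ c → 2 * suc (length c + length ps) ≤ 2 + 2 * length ps) (sym (outermost c ch bs))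
      (≤-reflexive (*-suc 2 (length ps)))
    where
    x′ : Fin n
    x′ = fromℕ< x<n
    x≡ : toℕ x′ ≡ x
    x≡ = FinP.toℕ-fromℕ< x<n
    before : ∀ ps → Inside (x ∷ c) ps → OpenBefore x′ ps
    before []       _             = tt
    before (_ ∷ ps) ((x<i , _) ∷ _) = subst (_< _) (sym x≡) x<i
    -- An arc around the open arc of `x` would end beyond `n` and so be open too, but open arcs
    -- cross since `n + i` increases with i.
    outermost : ∀ c → Chain (x ∷ c) → All (λ x → x < n × x < g x) c → c ≡ []
    outermost []      _                        _              = refl
    outermost (y ∷ _) ((y<x , gx<gy) ∷ _) ((y<n , _) ∷ _) =
      contradiction (subst₂ _<_ (g-fixed fx) (g-fixed fy) gx<gy) (<⇒≯ (+-monoʳ-< n y<x))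
      where
      fy : f y ≡ y
      fy = g-late y<n (≤-trans (m≤m+n n x) (subst (_≤ g y) (g-fixed fx) (<⇒≤ gx<gy)))
  unwind-∷ x c ps (no ¬fx) ch ((x<n , x<gx) ∷ bs) ins as nest with unwind c ((x′ , y′) ∷ ps) (Linked.tail ch) bs
      (All.map (λ { (l , r) → subst (_ <_) (sym x≡) l , subst (_< _) (sym y≡) r }) (chain-above ch))
      ((FinP.toℕ-injective (trans (sym (fun-toℕ α x′)) (trans (cong f x≡) (trans (sym (g-moved ¬fx)) (sym y≡)))) ,
        subst₂ _<_ (sym x≡) (sym y≡) x<gx) ∷ as)
      (nested ps ins nest)
    where
    x′ y′ : Fin n
    x′ = fromℕ< x<n
    y′ = fromℕ< (fun-< α x x<n)
    x≡ : toℕ x′ ≡ x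
    x≡ = FinP.toℕ-fromℕ< x<n
    y≡ : toℕ y′ ≡ g x
    y≡ = trans (FinP.toℕ-fromℕ< _) (sym (g-moved ¬fx))
    nested : ∀ ps → Inside (x ∷ c) ps → Nested ps → Nested ((x′ , y′) ∷ ps)
    nested []       _                nest = tt
    nested (_ ∷ ps) ((l , r) ∷ _)    nest = subst (_< _) (sym x≡) l , subst (_ <_) (sym y≡) r , nest
  ... | z , nesting , le = z , nesting , subst (λ k → 2 * k ≤ suc (futDots z)) (+-suc (length c) (length ps)) le

  obstruction⇒nesting : ∀ {M} → Obstruction M → ∃ λ x → FutNesting α x × 2 * M < futDots x
  obstruction⇒nesting {M} (arcs c ch len bs) with unwind c [] ch bs tt [] tt
  ... | x , nesting , le = x , nesting , s≤s⁻¹ (subst (_≤ suc (futDots x))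
    (trans (cong (2 *_) (trans (+-identityʳ (length c)) len)) (*-suc 2 M)) le)
  -- There are no loops, because `g` sends the fixed points of α to `n` or beyond.
  obstruction⇒nesting (loop i c i<n gi _ _ _) = contradiction gi moved
    where
    moved : g i ≢ i
    moved e with f i ≟ i
    ... | yes _  = <⇒≢ (<-≤-trans i<n (m≤m+n n i)) (sym e)
    ... | no ¬fi = ¬fi e

  encoded : ∃ (Enc f n (fixedList α))
  encoded = encode f n (fixedList α) (All.tabulate (proj₁ ∘ ∈-fixedList⁻ α))
    (ascending-unique (fixedList-ascending α)) matched

  fixes≡0 : ∀ {w} → Enc f n (fixedList α) w → fixes w ≡ 0
  fixes≡0 e = card-unique (fixes-card e)
    (card-empty λ { i (i<n , i∉ , fi) → i∉ (∈-fixedList⁺ α i i<n fi) })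

  code≡ : code (fixedList α) ≡ replicate (fixedPoints α) 0
  code≡ = trans (code-ascending (fixedList-ascending α)) (cong (λ k → replicate k 0) (length-fixedList α))

  bound-or-nesting : ∀ M → FutAtMost (2 * M) α ⊎ ∃ λ x → FutNesting α x × 2 * M < futDots x
  bound-or-nesting M with encoded
  ... | w , e with good-or-obstruction M e initial
  ...   | inj₁ good = inj₁ (good⇒bound good e)
  ...   | inj₂ o    = inj₂ (obstruction⇒nesting o)

  bound⇒good : ∀ M → FutAtMost (2 * M) α →
    ∃ λ w → Good M n 0 (replicate (fixedPoints α) 0) w × Enc f n (fixedList α) w
  bound⇒good M bound with encoded
  ... | w , e with good-or-obstruction M e initial
  ...   | inj₁ good = w , subst₂ (λ k σ → Good M n k σ w) (fixes≡0 e) code≡ good , e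
  ...   | inj₂ o with obstruction⇒nesting o
  ...     | x , nesting , lt = contradiction (bound x nesting) (<⇒≱ lt)

replicate-valid : ∀ m → Valid (replicate m 0)
replicate-valid zero    = tt
replicate-valid (suc m) = z≤n , replicate-valid m

fut-card : ∀ n M m → Card (FutClass n M m) (count M n 0 (replicate m 0))
fut-card n M m = card-transport {R = λ α w → Enc (fun α) n (fixedList α) w} total
  (λ { α (inv , refl , bound) → Future.bound⇒good α inv M bound })
  (λ _ → enc-functional) injective (good-card M n 0 (replicate m 0))
  where
  injective : ∀ {α β w} → FutClass n M m α → FutClass n M m β →
    Enc (fun α) n (fixedList α) w → Enc (fun β) n (fixedList β) w → α ≡ β
  injective {α} {β} (inv , refl , _) (inv′ , eq , _) e e′
    with enc-injective e e′ (trans (Future.code≡ α inv)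
           (trans (cong (λ k → replicate k 0) (sym eq)) (sym (Future.code≡ β inv′))))
  ... | same , agree = fun-injective value
    where
    value : ∀ i → i < n → fun α i ≡ fun β i
    value i i<n with i ∈? fixedList α
    ... | no i∉  = agree i i<n i∉
    ... | yes i∈ = trans (proj₂ (∈-fixedList⁻ α i∈)) (sym (proj₂ (∈-fixedList⁻ β (subst (i ∈_) same i∈))))

  total : ∀ w → Good M n 0 (replicate m 0) w → ∃ λ α → FutClass n M m α × Enc (fun α) n (fixedList α) w
  total w good with decode good (replicate-valid m)
  ... | f₀ , p , e₀ , eq = perm ,
    (inv , trans (sym (length-fixedList perm)) (trans (cong length (sym p≡)) length-p) ,
     good⇒bound (subst (λ σ → Good M n 0 σ w) (sym code′) good) e) , e
    where
    -- Nothing is known of `f₀` on the openers `p` left pending at time `n`; they are made fixed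
    -- points. By `moved` there are no others, as the word has no `fix` steps.
    f : ℕ → ℕ
    f i with i ∈? p
    ... | yes _ = i
    ... | no  _ = f₀ i
    f-∈ : ∀ {i} → i ∈ p → f i ≡ i
    f-∈ {i} m with i ∈? p
    ... | yes _ = refl
    ... | no i∉ = contradiction m i∉
    f-∉ : ∀ {i} → i ∉ p → f i ≡ f₀ i
    f-∉ {i} i∉ with i ∈? p
    ... | yes m = contradiction m i∉
    ... | no _  = refl
    f< : ∀ i → i < n → f i < n
    f< i i<n with i ∈? p
    ... | yes _ = i<n
    ... | no i∉ = proj₁ (enc-matched e₀ i i<n i∉)
    ff : ∀ i → i < n → f (f i) ≡ i
    ff i i<n with i ∈? p
    ... | yes m = f-∈ m
    ... | no i∉ with enc-matched e₀ i i<n i∉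
    ...   | _ , f₀i∉ , f₀f₀i = trans (f-∉ f₀i∉) f₀f₀i
    open FromFunction {n} f f<
    inv : IsInvolution perm
    inv = perm-involution ff
    open Future perm inv using (good⇒bound)
    moved : ∀ i → i < n → i ∉ p → f₀ i ≢ i
    moved i i<n i∉ f₀i = card-zero (subst (Card _) (good-fixes good) (fixes-card e₀)) i (i<n , i∉ , f₀i)
    p≡ : p ≡ fixedList perm
    p≡ = ascending-ext (ascending-code m (enc-unique e₀) eq) (fixedList-ascending perm)
      (λ {i} i∈p → let i<n = All.lookup (enc-< e₀) i∈p in
         ∈-fixedList⁺ perm i i<n (trans (fun-perm i i<n) (f-∈ i∈p)))
      back
      where
      back : ∀ {i} → i ∈ fixedList perm → i ∈ p
      back {i} i∈ with i ∈? p | ∈-fixedList⁻ perm i∈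
      ... | yes i∈p | _          = i∈p
      ... | no i∉p  | i<n , fi = contradiction
        (trans (sym (f-∉ i∉p)) (trans (sym (fun-perm i i<n)) fi)) (moved i i<n i∉p)
    length-p : length p ≡ m
    length-p = trans (sym (length-code p)) (trans (cong length eq) (length-replicate m))
    code′ : code (fixedList perm) ≡ replicate m 0
    code′ = trans (cong code (sym p≡)) eq
    e : Enc (fun perm) n (fixedList perm) w
    e = subst (λ q → Enc (fun perm) n q w) p≡
      (enc-cong e₀ λ i i<n i∉ → sym (trans (fun-perm i i<n) (f-∉ i∉)))

-- Differences of enumerated sets

card-dec : {A : Set} → DecidableEquality A → {P : A → Set} {k : ℕ} → Card P k → ∀ x → Dec (P x)
card-dec _≟ᴬ_ (l , _ , l⇔P , _) x = map′ (to (l⇔P x)) (from (l⇔P x)) (member? _≟ᴬ_ x l)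

card-filter : {A : Set} {P Q : A → Set} {k : ℕ} → Card P k → (∀ x → Dec (Q x)) →
              ∃ (Card (λ x → P x × Q x))
card-filter {P = P} {Q} (l , u , l⇔P , _) Q? = _ , filter Q? l , UniqueP.filter⁺ Q? u ,
  (λ x → mk⇔ (λ m → let x∈l , q = ∈-filter⁻ Q? {xs = l} m in to (l⇔P x) x∈l , q)
              (λ { (p , q) → ∈-filter⁺ Q? (from (l⇔P x) p) q })) , refl

-- Both differences arise from sets of the same size by removing their intersection. Membership is
-- decidable because the sets are enumerated.
card-difference : {A : Set} → DecidableEquality A → {P Q : A → Set} {a k : ℕ} →
  Card P a → Card Q a → Card (λ x → P x × ¬ Q x) k → Card (λ x → Q x × ¬ P x) k
card-difference _≟ᴬ_ {P} {Q} {a} {k} cP cQ cPQ with card-dec _≟ᴬ_ cP | card-dec _≟ᴬ_ cQ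
... | P? | Q? with card-filter cP Q? | card-filter cQ (λ x → ¬? (P? x))
... | c , both | d , cQP = subst (Card _) (+-cancelˡ-≡ c d k (trans (sym splitQ) splitP)) cQP
  where
  splitP : a ≡ c + k
  splitP = card-unique cP (card-cong (λ { x (inj₁ (p , _)) → p ; x (inj₂ (p , _)) → p })
    (λ x p → decide x p (Q? x))
    (card-⊎ (λ { x (_ , q) (_ , ¬q) → ¬q q }) both cPQ))
    where
    decide : ∀ x → P x → Dec (Q x) → (P x × Q x) ⊎ (P x × ¬ Q x)
    decide x p (yes q) = inj₁ (p , q)
    decide x p (no ¬q) = inj₂ (p , ¬q)
  splitQ : a ≡ c + d
  splitQ = card-unique cQ (card-cong (λ { x (inj₁ (_ , q)) → q ; x (inj₂ (q , _)) → q })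
    (λ x q → decide x q (P? x))
    (card-⊎ (λ { x (p , _) (_ , ¬p) → ¬p p }) both cQP))
    where
    decide : ∀ x → Q x → Dec (P x) → (P x × Q x) ⊎ (Q x × ¬ P x)
    decide x q (yes p) = inj₁ (p , q)
    decide x q (no ¬p) = inj₂ (q , ¬p)

-- From bounds to fibers

futArcs-dots : ∀ {n} (a : Maybe (Fin n)) (ps : List (Fin n × Fin n)) →
  2 * length ps ≤ futDots (a , ps) × futDots (a , ps) ≤ 1 + 2 * length ps
futArcs-dots nothing  ps = ≤-refl , n≤1+n _
futArcs-dots (just _) ps = n≤1+n _ , ≤-refl

futArcs : ∀ {n} (α : Perm n) (a : Maybe (Fin n)) {ps} → FutNesting α (a , ps) → All (ClosedArc α) ps × Nested ps
futArcs α nothing  (as , nest)         = as , nest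
futArcs α (just _) (_ , as , nest , _) = as , nest

closed-bounds : ∀ {n} (ps : List (Fin n × Fin n)) →
  2 * length (closed ps) ≤ enhDots ps × enhDots ps ≤ 1 + 2 * length (closed ps)
closed-bounds ps with closed-dots ps
... | inj₁ e = ≤-reflexive (sym e) , ≤-trans (≤-reflexive e) (n≤1+n _)
... | inj₂ e = ≤-trans (n≤1+n _) (≤-reflexive (sym e)) , ≤-reflexive e

double-cancel : ∀ {k l} → 2 * k ≤ 1 + 2 * l → k ≤ l
double-cancel {zero}          le = z≤n
double-cancel {suc k} {zero}  le = contradiction (subst (_≤ 1) (*-suc 2 k) le) λ { (s≤s ()) }
double-cancel {suc k} {suc l} le = s≤s (double-cancel (s≤s⁻¹ (s≤s⁻¹
  (subst₂ _≤_ (*-suc 2 k) (cong suc (*-suc 2 l)) le))))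

-- M is the number of closed arcs in a maximal nesting of the open matching. Stripped of its open
-- arc or loop, each of the two maximal nestings is a candidate for the other statistic, so
-- `double-cancel` shows that they have equally many closed arcs.
fiber-halves : ∀ {n m a b} {α : Perm n} → Fiber n m a b α →
  ∃ λ M → (a ≡ 2 * M ⊎ a ≡ 1 + 2 * M) × (b ≡ 2 * M ⊎ b ≡ 1 + 2 * M)
fiber-halves {a = a} {b} {α} (_ , _ , (((o , ps) , futN , fut≡) , fut≤) , ((qs , enhN , enh≡) , enh≤)) =
  length ps , subst (λ d → d ≡ 2 * length ps ⊎ d ≡ 1 + 2 * length ps) fut≡ (futDots-cases o) ,
  subst₂ (λ d k → d ≡ 2 * k ⊎ d ≡ 1 + 2 * k) enh≡ (sym lengths) (closed-dots qs)
  where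
  futDots-cases : ∀ o → futDots (o , ps) ≡ 2 * length ps ⊎ futDots (o , ps) ≡ 1 + 2 * length ps
  futDots-cases nothing  = inj₁ refl
  futDots-cases (just _) = inj₂ refl
  arcs = futArcs α o futN
  lengths : length ps ≡ length (closed qs)
  lengths = ≤-antisym
    (double-cancel (≤-trans (≤-reflexive (sym (closed-enhDots α ps (proj₁ arcs))))
      (≤-trans (enh≤ ps (closed⇒enh α (proj₁ arcs) (proj₂ arcs)))
        (≤-trans (≤-reflexive (sym enh≡)) (proj₂ (closed-bounds qs))))))
    (double-cancel (≤-trans (fut≤ (nothing , closed qs) (closed-nesting α qs enhN))
      (≤-trans (≤-reflexive (sym fut≡)) (proj₂ (futArcs-dots o ps)))))

module _ {n m : ℕ} (M : ℕ) (α : Perm n) where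

  -- Some enhanced nesting has more than 2M dots, but the bound on futne allows at most M closed
  -- arcs. Hence it consists of M arcs and a loop, and its arcs alone attain the bound on futne.
  fiber-even-odd⁺ : FutClass n M m α × ¬ EnhClass n M m α → Fiber n m (2 * M) (1 + 2 * M) α
  fiber-even-odd⁺ ((inv , fp , fut≤) , ¬enh) with Enhanced.bound-or-nesting α inv M
  ... | inj₁ enh≤ = contradiction (inv , fp , enh≤) ¬enh
  ... | inj₂ (ps , nesting , lt) = inv , fp ,
    (((nothing , closed ps) , closed-nesting α ps nesting , cong (2 *_) length≡) , fut≤) ,
    ((ps , nesting , ≤-antisym (at-most ps nesting) lt) , at-most)
    where
    short : ∀ ps → EnhNesting α ps → length (closed ps) ≤ M
    short ps nesting = *-cancelˡ-≤ 2 (fut≤ (nothing , closed ps) (closed-nesting α ps nesting))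
    at-most : EnhAtMost (1 + 2 * M) α
    at-most ps nesting = ≤-trans (proj₂ (closed-bounds ps)) (s≤s (*-monoʳ-≤ 2 (short ps nesting)))
    length≡ : length (closed ps) ≡ M
    length≡ = ≤-antisym (short ps nesting)
      (*-cancelˡ-≤ 2 (s≤s⁻¹ (≤-trans lt (proj₂ (closed-bounds ps)))))

  fiber-even-odd⁻ : Fiber n m (2 * M) (1 + 2 * M) α → FutClass n M m α × ¬ EnhClass n M m α
  fiber-even-odd⁻ (inv , fp , (_ , fut≤) , ((ps , nesting , e) , _)) = (inv , fp , fut≤) ,
    λ { (_ , _ , enh≤) → contradiction (enh≤ ps nesting) (<⇒≱ (≤-reflexive (sym e))) }

  -- The same argument with an open arc in place of the loop.
  fiber-odd-even⁺ : EnhClass n M m α × ¬ FutClass n M m α → Fiber n m (1 + 2 * M) (2 * M) α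
  fiber-odd-even⁺ ((inv , fp , enh≤) , ¬fut) with Future.bound-or-nesting α inv M
  ... | inj₁ fut≤ = contradiction (inv , fp , fut≤) ¬fut
  ... | inj₂ ((o , ps) , nesting , lt) = inv , fp ,
    (((o , ps) , nesting , ≤-antisym (at-most (o , ps) nesting) lt) , at-most) ,
    ((ps , closed⇒enh α (proj₁ arcs) (proj₂ arcs) ,
      trans (closed-enhDots α ps (proj₁ arcs)) (cong (2 *_) length≡)) , enh≤)
    where
    arcs = futArcs α o nesting
    short : ∀ o ps → FutNesting α (o , ps) → length ps ≤ M
    short o ps nesting with futArcs α o nesting
    ... | as , nest = *-cancelˡ-≤ 2
      (≤-trans (≤-reflexive (sym (closed-enhDots α ps as))) (enh≤ ps (closed⇒enh α as nest)))
    at-most : FutAtMost (1 + 2 * M) α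
    at-most (o , ps) nesting = ≤-trans (proj₂ (futArcs-dots o ps)) (s≤s (*-monoʳ-≤ 2 (short o ps nesting)))
    length≡ : length ps ≡ M
    length≡ = ≤-antisym (short o ps nesting)
      (*-cancelˡ-≤ 2 (s≤s⁻¹ (≤-trans lt (proj₂ (futArcs-dots o ps)))))

  fiber-odd-even⁻ : Fiber n m (1 + 2 * M) (2 * M) α → EnhClass n M m α × ¬ FutClass n M m α
  fiber-odd-even⁻ (inv , fp , ((x , nesting , e) , _) , (_ , enh≤)) = (inv , fp , enh≤) ,
    λ { (_ , _ , fut≤) → contradiction (fut≤ x nesting) (<⇒≱ (≤-reflexive (sym e))) }

perm-≟ : ∀ {n} → DecidableEquality (Perm n)
perm-≟ = VecP.≡-dec FinP._≟_

-- If a and b differ, the two fibers are the two differences of `FutClass` and `EnhClass`, whose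
-- cardinalities agree by `count-open≡count-fixed`.
fiber-swap : ∀ n m {a b k} M → a ≡ 2 * M ⊎ a ≡ 1 + 2 * M → b ≡ 2 * M ⊎ b ≡ 1 + 2 * M →
             Card (Fiber n m a b) k → Card (Fiber n m b a) k
fiber-swap n m M (inj₁ refl) (inj₁ refl) c = c
fiber-swap n m M (inj₂ refl) (inj₂ refl) c = c
fiber-swap n m M (inj₁ refl) (inj₂ refl) c = card-cong (fiber-odd-even⁺ M) (fiber-odd-even⁻ M)
  (card-difference perm-≟ (fut-card n M m)
    (subst (Card _) (count-open≡count-fixed M n m) (enh-card n M m))
    (card-cong (fiber-even-odd⁻ M) (fiber-even-odd⁺ M) c))
fiber-swap n m M (inj₂ refl) (inj₁ refl) c = card-cong (fiber-even-odd⁺ M) (fiber-even-odd⁻ M)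
  (card-difference perm-≟ (subst (Card _) (count-open≡count-fixed M n m) (enh-card n M m))
    (fut-card n M m)
    (card-cong (fiber-odd-even⁻ M) (fiber-odd-even⁺ M) c))

-- The two fibers are counted by the coefficients of x^a y^b on the two sides. One implication
-- suffices, as a and b are arbitrary.
theorem14 : (n m a b k : ℕ) → HasCount (Fiber n m a b) k → HasCount (Fiber n m b a) k
theorem14 n m a b k c@(α ∷ _ , _ , l⇔fiber , _) with fiber-halves (to (l⇔fiber α) (here refl))
... | M , a≡ , b≡ = fiber-swap n m M a≡ b≡ c
-- An empty fiber provides no involution from which to read off M. A supposed element of the swapped
-- fiber provides it and is then refuted by `fiber-swap`.
theorem14 n m a b .0 c@([] , _ , _ , refl) = card-empty λ α fiber →
  let M , b≡ , a≡ = fiber-halves fiber in card-zero (fiber-swap n m M a≡ b≡ c) α fiber
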